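{- Let $k\geq 3$ be an integer and let $D$ be a strongly connected digraph. If $\chi(D)>(2k-2)(2k-3)$, then $D$ contains a subdivision of $B(k,1;1)$.
   Context: Digraphs are finite, without loops or parallel arcs (opposite arcs allowed). $\chi(D)$ is the chromatic number of the underlying undirected graph of $D$. A digraph is strongly connected if every vertex can reach every other vertex by a directed path. For positive integers $k_1,k_2,k_3$, a digraph $D$ contains a subdivision of $B(k_1,k_2;k_3)$ if there exist distinct vertices $x,y$ of $D$ and three pairwise internally vertex-disjoint directed paths in $D$: two from $x$ to $y$, of lengths (numbers of arcs) at least $k_1$ and at least $k_2$ respectively, and one from $y$ to $x$ of length at least $k_3$. -}

module Defs where

open import Data.Fin.Base using (Fin)
open import Data.List.Base using (List; []; _∷_)
open import Data.List.Relation.Binary.Disjoint.Propositional using (Disjoint)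
open import Data.List.Relation.Unary.Unique.Propositional using (Unique)
open import Data.Nat.Base using (ℕ; zero; suc; _≤_)
open import Data.Product.Base using (Σ-syntax; _×_)
open import Level using (0ℓ)
open import Relation.Binary.Construct.Closure.ReflexiveTransitive using (Star; ε; _◅_)
open import Relation.Binary.Construct.Closure.Symmetric using (SymClosure)
open import Relation.Binary.Core using (Rel)
open import Relation.Binary.Definitions using (Decidable)
open import Relation.Binary.PropositionalEquality.Core using (_≢_)
open import Relation.Nullary.Negation.Core using (¬_)

-- Arcs form a relation, so there are no parallel arcs; opposite arcs are
-- allowed.  Decidability is what "finite digraph" provides classically.
record Digraph (n : ℕ) : Set₁ where
  field
    Arc      : Rel (Fin n) 0ℓ
    arc?     : Decidable Arc
    loopless : ∀ v → ¬ Arc v v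

module _ {n : ℕ} (D : Digraph n) where
  open Digraph D

  Adjacent : Rel (Fin n) 0ℓ
  Adjacent = SymClosure Arc

  Colourable : ℕ → Set
  Colourable c = Σ[ f ∈ (Fin n → Fin c) ] (∀ u v → Adjacent u v → f u ≢ f v)

  IsChromaticNumber : ℕ → Set
  IsChromaticNumber χ = Colourable χ × (∀ c → Colourable c → χ ≤ c)

  Walk : Rel (Fin n) 0ℓ
  Walk = Star Arc

  length : ∀ {u v} → Walk u v → ℕ
  length ε       = zero
  length (_ ◅ w) = suc (length w)

  vertices : ∀ {u v} → Walk u v → List (Fin n)
  vertices {u} ε       = u ∷ []
  vertices {u} (_ ◅ w) = u ∷ vertices w

  -- The vertices other than the first and the last one.
  interior : ∀ {u v} → Walk u v → List (Fin n)
  interior ε                     = []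
  interior (_ ◅ ε)               = []
  interior (_ ◅ w@(_◅_ {i} _ _)) = i ∷ interior w

  record Path (u v : Fin n) : Set where
    field
      walk   : Walk u v
      simple : Unique (vertices walk)

  open Path

  StronglyConnected : Set
  StronglyConnected = ∀ u v → u ≢ v → Path u v

  InternallyDisjoint : ∀ {u v u′ v′} → Path u v → Path u′ v′ → Set
  InternallyDisjoint P Q = Disjoint (interior (walk P)) (interior (walk Q))

  -- A subdivision of B(k₁,k₂;k₃).  The endpoints lie in {x, y} and paths are
  -- simple, so an interior never meets the endpoints of another path.
  -- `distinct` only matters when k₁, k₂ ≤ 1: without it a single arc, whose
  -- interior is empty, could serve as both P₁ and P₂.
  record BSubdivision (k₁ k₂ k₃ : ℕ) : Set where
    field
      x y        : Fin n
      x≢y        : x ≢ y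
      P₁ P₂      : Path x y
      P₃         : Path y x
      length₁    : k₁ ≤ length (walk P₁)
      length₂    : k₂ ≤ length (walk P₂)
      length₃    : k₃ ≤ length (walk P₃)
      distinct   : vertices (walk P₁) ≢ vertices (walk P₂)
      disjoint₁₂ : InternallyDisjoint P₁ P₂
      disjoint₁₃ : InternallyDisjoint P₁ P₃
      disjoint₂₃ : InternallyDisjoint P₂ P₃

{-# OPTIONS --safe #-}
-- Colourings can be glued at a cut vertex, so it suffices to colour a strong digraph without
-- one.  If all its cycles have at most N vertices, N colours suffice by a theorem of Bondy.
-- Otherwise fix a cycle C with more than N ≥ 3k vertices and suppose there is no subdivision of
-- B(k,1;1).  Then every ear of C from a to b is shorter than k, and so is the segment of C from
-- a to b; the segment from b to a therefore has length at least k, which forbids ears that run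
-- against it.  Since there is no cut vertex, it follows that the digraph outside C is acyclic,
-- and that each walk there extends to an ear, so that it has fewer than k arcs.  The vertices
-- outside C are coloured by the length of a longest walk ending there, those of C by their
-- position, since chords of C only join positions at distance less than k: at most 3k colours.
module Submission where

open import Defs
open import Data.Nat.Base using (ℕ; _≥_; _>_; _*_; _∸_)
open import Data.Empty using (⊥; ⊥-elim)
open import Data.Fin.Base as Fin using (Fin)
open import Data.Fin.Permutation.Components using (transpose; transpose-inverse)
open import Data.Fin.Properties as Fin using (_≟_; any?)
open import Data.Fin.Subset as Subset using (Subset; _⊂_; ⊤)
open import Data.Fin.Subset.Induction using (⊂-wellFounded)
open import Data.Fin.Subset.Properties using (_∈?_; ∈⊤)
open import Data.List.Base as List using (List; []; _∷_)
open import Data.List.Membership.DecPropositional using () renaming (_∈?_ to ∈-dec)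
open import Data.List.Membership.Propositional using (_∈_; _∉_)
open import Data.List.Membership.Propositional.Properties using (∈-lookup)
import Data.List.Properties as List
open import Data.List.Relation.Binary.Disjoint.DecPropositional using (disjoint?)
open import Data.List.Relation.Binary.Disjoint.Propositional using (Disjoint)
open import Data.List.Relation.Unary.All as All using ([]; _∷_)
open import Data.List.Relation.Unary.AllPairs using ([]; _∷_)
open import Data.List.Relation.Unary.Any using (here; there)
open import Data.List.Relation.Unary.Unique.DecPropositional using (unique?)
open import Data.List.Relation.Unary.Unique.Propositional using (Unique)
open import Data.Nat.Base using (zero; suc; pred; _≤_; _<_; _+_; z≤n; s≤s; NonZero; >-nonZero; >-nonZero⁻¹)
open import Data.Nat.DivMod using (_%_; _mod_; %-distribˡ-+; [m+n]%n≡m%n; [m+kn]%n≡m%n; m<n⇒m%n≡m; m%n<n)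
open import Data.Nat.Divisibility using (_∣_; ∣⇒≤; m%n≡0⇒n∣m)
import Data.Nat.Properties as ℕ
open import Data.Product.Base using (Σ-syntax; ∃-syntax; _×_; _,_; proj₁; proj₂)
open import Data.Sum.Base as Sum using (_⊎_; inj₁; inj₂)
import Data.Unit.Base as Unit
open import Data.Vec.Base using (tabulate)
open import Data.Vec.Properties using (lookup∘tabulate; []=⇒lookup; lookup⇒[]=)
open import Function.Base using (_∘_)
open import Induction.WellFounded using (Acc; acc)
open import Relation.Binary.Construct.Closure.ReflexiveTransitive as Star using (Star; ε; _◅_; _◅◅_)
import Relation.Binary.Construct.Closure.Symmetric as Sym
open import Relation.Binary.Core using (Rel)
open import Relation.Binary.PropositionalEquality
open import Relation.Nullary using (¬_; Dec; yes; no; does)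
open import Relation.Nullary.Decidable using (map′; ¬?; _×-dec_; _⊎-dec_; ¬¬-excluded-middle; decidable-stable; dec-true)
open import Relation.Unary using (Decidable)

-- Paths

-- The target is decidable by a search over paths, so the argument may be classical: it derives `⊥`
-- from the absence of a subdivision, and predicates are taken to be decidable under double
-- negation. Running against a long segment is fatal for this reason: let a strongly connected set K
-- contain x and y, x ≠ y, and let a path of length at least k lead from y to x, otherwise outside
-- K. Then paths inside K in both directions complete it to a subdivision. The long path leaves K
-- along an ear to b, follows the cycle from b to a and enters K along an ear from a. Hence a strong
-- component outside the cycle is entered and left at one vertex, which would be a cut vertex;
-- closed walks attached to a vertex of the cycle are excluded in the same way. This is why
-- colourings are first split at cut vertices. Of the 3k colours, k are for the outside and 2k for
-- the cycle, because the number of its vertices need not be divisible by k.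

module Paths {n : ℕ} (D : Digraph n) where
  open Digraph D
  open Path

  private
    V = Fin n

  _∈ₚ_ : ∀ {u v} → V → Path D u v → Set
  z ∈ₚ p = z ∈ vertices D (walk p)

  _∈ₚ?_ : ∀ {u v} (z : V) (p : Path D u v) → Dec (z ∈ₚ p)
  z ∈ₚ? p = ∈-dec _≟_ z (vertices D (walk p))

  len : ∀ {u v} → Path D u v → ℕ
  len p = length D (walk p)

  first∈ : ∀ {u v} (w : Walk D u v) → u ∈ vertices D w
  first∈ ε       = here refl
  first∈ (_ ◅ _) = here refl

  last∈ : ∀ {u v} (w : Walk D u v) → v ∈ vertices D w
  last∈ ε       = here refl
  last∈ (_ ◅ w) = there (last∈ w)

  nontrivial : ∀ {u v} → u ≢ v → (w : Walk D u v) → 0 < length D w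
  nontrivial u≢v ε       = ⊥-elim (u≢v refl)
  nontrivial u≢v (_ ◅ _) = s≤s z≤n

  trivial : ∀ u → Path D u u
  trivial u = record { walk = ε ; simple = [] ∷ [] }

  consPath : ∀ {u v w} → Arc u v → (p : Path D v w) → ¬ (u ∈ₚ p) → Path D u w
  consPath a p u∉p = record
    { walk   = a ◅ walk p
    ; simple = All.tabulate (λ z∈p u≡z → u∉p (subst (_∈ₚ p) (sym u≡z) z∈p)) ∷ simple p }

  start∉tail : ∀ {u v w} {a : Arc u v} {p : Walk D v w} →
               Unique (vertices D (a ◅ p)) → u ∉ vertices D p
  start∉tail (u≢ ∷ _) u∈ = All.lookup u≢ u∈ refl

  join-∈ : ∀ {u v w z} (p : Walk D u v) (q : Walk D v w) →
           z ∈ vertices D (p ◅◅ q) → z ∈ vertices D p ⊎ z ∈ vertices D q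
  join-∈ ε       q z∈         = inj₂ z∈
  join-∈ (_ ◅ p) q (here eq)  = inj₁ (here eq)
  join-∈ (_ ◅ p) q (there z∈) = Sum.map₁ there (join-∈ p q z∈)

  join-length : ∀ {u v w} (p : Walk D u v) (q : Walk D v w) →
                length D (p ◅◅ q) ≡ length D p + length D q
  join-length ε       q = refl
  join-length (_ ◅ p) q = cong suc (join-length p q)

  join-unique : ∀ {u v w} (p : Walk D u v) (q : Walk D v w) →
                Unique (vertices D p) → Unique (vertices D q) →
                (∀ {z} → z ∈ vertices D p → z ∈ vertices D q → z ≡ v) →
                Unique (vertices D (p ◅◅ q))
  join-unique ε       q _           uq _    = uq
  join-unique (a ◅ p) q (u≢ ∷ up) uq meet =
    All.tabulate fresh ∷ join-unique p q up uq (meet ∘ there)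
    where
    fresh : ∀ {z} → z ∈ vertices D (p ◅◅ q) → _ ≢ z
    fresh z∈ refl with join-∈ p q z∈
    ... | inj₁ u∈p = All.lookup u≢ u∈p refl
    ... | inj₂ u∈q = All.lookup u≢ (last∈ p) (meet (here refl) u∈q)

  module _ {u v w} (p : Path D u v) (q : Path D v w)
           (meet : ∀ {z} → z ∈ₚ p → z ∈ₚ q → z ≡ v) where

    join : Path D u w
    join = record
      { walk   = walk p ◅◅ walk q
      ; simple = join-unique (walk p) (walk q) (simple p) (simple q) meet }

  -- Junk (the length of the list) if z does not occur.
  index : List V → V → ℕ
  index []       z = zero
  index (x ∷ xs) z with x ≟ z
  ... | yes _ = zero
  ... | no  _ = suc (index xs z)

  index-head : ∀ x xs → index (x ∷ xs) x ≡ 0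
  index-head x xs with x ≟ x
  ... | yes _  = refl
  ... | no x≢x = ⊥-elim (x≢x refl)

  index-tail : ∀ {x z} xs → x ≢ z → index (x ∷ xs) z ≡ suc (index xs z)
  index-tail {x} {z} xs x≢z with x ≟ z
  ... | yes x≡z = ⊥-elim (x≢z x≡z)
  ... | no _    = refl

  pos : ∀ {u v} → Path D u v → V → ℕ
  pos p = index (vertices D (walk p))

  pos-tail : ∀ {u v w z} (a : Arc u v) (p : Walk D v w) → Unique (vertices D (a ◅ p)) →
             z ∈ vertices D p →
             index (vertices D (a ◅ p)) z ≡ suc (index (vertices D p) z)
  pos-tail a p uniq z∈p = index-tail (vertices D p) λ { refl → start∉tail {a = a} {p} uniq z∈p }

  pos-last : ∀ {u v} (p : Walk D u v) → Unique (vertices D p) →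
             index (vertices D p) v ≡ length D p
  pos-last ε       _               = index-head _ []
  pos-last (a ◅ p) uniq@(_ ∷ up) = trans (pos-tail a p uniq (last∈ p)) (cong suc (pos-last p up))

  pos≤length : ∀ {u v z} (p : Walk D u v) → z ∈ vertices D p →
               index (vertices D p) z ≤ length D p
  pos≤length {u} {z = z} ε _ with u ≟ z
  ... | yes _ = z≤n
  pos≤length {u} ε (here z≡u) | no u≢z = ⊥-elim (u≢z (sym z≡u))
  pos≤length {u} {z = z} (a ◅ p) z∈ with u ≟ z
  ... | yes _ = z≤n
  pos≤length {u} (a ◅ p) (here z≡u) | no u≢z = ⊥-elim (u≢z (sym z≡u))
  pos≤length {u} (a ◅ p) (there z∈) | no u≢z = s≤s (pos≤length p z∈)

  record Split {u v} (p : Path D u v) (a : V) : Set where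
    field
      before     : Path D u a
      after      : Path D a v
      before⊆    : ∀ {z} → z ∈ₚ before → z ∈ₚ p
      after⊆     : ∀ {z} → z ∈ₚ after → z ∈ₚ p
      cover      : ∀ {z} → z ∈ₚ p → z ∈ₚ before ⊎ z ∈ₚ after
      meet       : ∀ {z} → z ∈ₚ before → z ∈ₚ after → z ≡ a
      len-split  : len before + len after ≡ len p
      pos-before : ∀ {z} → z ∈ₚ before → pos p z ≡ pos before z
      pos-after  : ∀ {z} → z ∈ₚ after → pos p z ≡ len before + pos after z

    pos-at : pos p a ≡ len before
    pos-at = trans (pos-before (last∈ (walk before))) (pos-last (walk before) (simple before))

  split : ∀ {u v a} (p : Path D u v) → a ∈ₚ p → Split p a
  split {u} p@(record { walk = ε }) (here refl) = record
    { before = trivial u ; after = p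
    ; before⊆ = λ z∈ → z∈ ; after⊆ = λ z∈ → z∈ ; cover = inj₁
    ; meet = λ { (here eq) _ → eq } ; len-split = refl
    ; pos-before = λ _ → refl ; pos-after = λ _ → refl }
  split {u} p@(record { walk = a ◅ w }) (here refl) = record
    { before = trivial u ; after = p
    ; before⊆ = λ { (here eq) → here eq } ; after⊆ = λ z∈ → z∈ ; cover = inj₂
    ; meet = λ { (here eq) _ → eq } ; len-split = refl
    ; pos-before = λ { (here refl) → trans (index-head u (vertices D w)) (sym (index-head u [])) }
    ; pos-after = λ _ → refl }
  split {u} p@(record { walk = a ◅ w ; simple = uniq@(_ ∷ uw) }) (there a∈w) = record
    { before = consPath a before (start∉tail {a = a} {w} uniq ∘ before⊆) ; after = after
    ; before⊆ = λ { (here eq) → here eq ; (there z∈) → there (before⊆ z∈) }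
    ; after⊆ = there ∘ after⊆
    ; cover = λ { (here eq) → inj₁ (here eq) ; (there z∈) → Sum.map₁ there (cover z∈) }
    ; meet = λ { (here refl) z∈ → ⊥-elim (start∉tail {a = a} {w} uniq (after⊆ z∈))
               ; (there z∈b) z∈a → meet z∈b z∈a }
    ; len-split = cong suc len-split
    ; pos-before = λ
        { (here refl) → trans (index-head u (vertices D w))
                              (sym (index-head u (vertices D (walk before))))
        ; (there z∈) → trans (pos-tail a w uniq (before⊆ z∈))
            (trans (cong suc (pos-before z∈))
              (sym (index-tail (vertices D (walk before))
                λ { refl → start∉tail {a = a} {w} uniq (before⊆ z∈) }))) }
    ; pos-after = λ z∈ → trans (pos-tail a w uniq (after⊆ z∈)) (cong suc (pos-after z∈)) }
    where
    rest : Split (record { walk = w ; simple = uw }) _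
    rest = split (record { walk = w ; simple = uw }) a∈w
    open Split rest

  ArcInto : (V → Set) → Rel V _
  ArcInto P u v = Arc u v × P v

  -- Every vertex of the walk but the first lies in P.
  WalkInto : (V → Set) → Rel V _
  WalkInto P = Star (ArcInto P)

  -- Loop erasure from the end: when the start `u` already lies on the path built for the rest, the
  -- part of that path before `u` is dropped.
  erase : ∀ {P u v} → WalkInto P u v → Σ[ p ∈ Path D u v ] (∀ {z} → z ∈ₚ p → z ≡ u ⊎ P z)
  erase {u = u} ε = trivial u , λ { (here eq) → inj₁ eq }
  erase {P} {u} ((a , Pw) ◅ rest) with erase rest
  ... | p , p⊆ with u ∈ₚ? p
  ...   | yes u∈p = let open Split (split p u∈p) in
    after , λ z∈ → Sum.[ (λ { refl → inj₂ Pw }) , inj₂ ] (p⊆ (after⊆ z∈))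
  ...   | no u∉p = consPath a p u∉p , λ
    { (here eq) → inj₁ eq
    ; (there z∈) → Sum.[ (λ { refl → inj₂ Pw }) , inj₂ ] (p⊆ z∈) }

  record Hit {u v} (T : V → Set) (p : Path D u v) : Set where
    field
      {t}   : V
      hit   : T t
      upto  : Path D u t
      upto⊆ : ∀ {z} → z ∈ₚ upto → z ∈ₚ p
      fresh : ∀ {z} → z ∈ₚ upto → T z → z ≡ t

  firstHit : ∀ {u v T} → Decidable T → (w : Walk D u v) (uniq : Unique (vertices D w)) → T v →
             Hit T (record { walk = w ; simple = uniq })
  firstHit {u} T? w uniq Tv with T? u
  ... | yes Tu = record
    { hit = Tu ; upto = trivial u
    ; upto⊆ = λ { (here refl) → first∈ w } ; fresh = λ { (here eq) _ → eq } }
  firstHit T? ε uniq Tv | no ¬Tu = ⊥-elim (¬Tu Tv)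
  firstHit T? (a ◅ w) uniq@(_ ∷ uw) Tv | no ¬Tu = record
    { hit = hit
    ; upto = consPath a upto (start∉tail {a = a} {w} uniq ∘ upto⊆)
    ; upto⊆ = λ { (here eq) → here eq ; (there z∈) → there (upto⊆ z∈) }
    ; fresh = λ { (here refl) Tu → ⊥-elim (¬Tu Tu) ; (there z∈) Tz → fresh z∈ Tz } }
    where open Hit (firstHit T? w uw Tv)

  interior-∈ : ∀ {u v z} (w : Walk D u v) → Unique (vertices D w) → z ∈ interior D w →
               z ∈ vertices D w × z ≢ u × z ≢ v
  interior-∈ (a ◅ w@(b ◅ w′)) uniq (here refl) =
    there (here refl) , (λ { refl → start∉tail {a = a} {w} uniq (here refl) }) ,
    λ { refl → start∉tail {a = b} {w′} (tail uniq) (last∈ w′) }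
    where
    tail : ∀ {x : V} {xs} → Unique (x ∷ xs) → Unique xs
    tail (_ ∷ u) = u
  interior-∈ (a ◅ w@(_ ◅ _)) uniq@(_ ∷ uw) (there z∈) with interior-∈ w uw z∈
  ... | z∈w , _ , z≢v = there z∈w , (λ { refl → start∉tail {a = a} {w} uniq z∈w }) , z≢v

  interior-nonempty : ∀ {u v} (w : Walk D u v) → 2 ≤ length D w → ∃[ z ] z ∈ interior D w
  interior-nonempty (_ ◅ (_ ◅ _)) _ = _ , here refl
  interior-nonempty (_ ◅ ε) (s≤s ())

  module _ {k} (2≤k : 2 ≤ k) where

    spindle : ∀ {s t} → s ≢ t → (P₁ P₂ : Path D s t) (P₃ : Path D t s) → k ≤ len P₁ →
              (∀ {z} → z ∈ₚ P₁ → z ∈ₚ P₂ → z ≡ s ⊎ z ≡ t) →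
              (∀ {z} → z ∈ₚ P₁ → z ∈ₚ P₃ → z ≡ s ⊎ z ≡ t) →
              (∀ {z} → z ∈ₚ P₂ → z ∈ₚ P₃ → z ≡ s ⊎ z ≡ t) →
              BSubdivision D k 1 1
    spindle {s} {t} s≢t P₁ P₂ P₃ k≤ m₁₂ m₁₃ m₂₃ = record
      { x≢y = s≢t ; P₁ = P₁ ; P₂ = P₂ ; P₃ = P₃ ; length₁ = k≤
      ; length₂ = nontrivial s≢t (walk P₂) ; length₃ = nontrivial (s≢t ∘ sym) (walk P₃)
      -- As `2 ≤ k`, `P₁` has an interior vertex, which cannot lie on `P₂`.
      ; distinct = λ eq → let (z , z∈) = interior-nonempty (walk P₁) (ℕ.≤-trans 2≤k k≤)
                              (z∈P₁ , z≢) = interior-∈ (walk P₁) (simple P₁) z∈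
                          in neither z≢ (m₁₂ z∈P₁ (subst (z ∈_) eq z∈P₁))
      ; disjoint₁₂ = λ (z∈₁ , z∈₂) → apart P₁ P₂ m₁₂ z∈₁ (proj₁ (interior-∈ (walk P₂) (simple P₂) z∈₂))
      ; disjoint₁₃ = λ (z∈₁ , z∈₃) → apart P₁ P₃ m₁₃ z∈₁ (proj₁ (interior-∈ (walk P₃) (simple P₃) z∈₃))
      ; disjoint₂₃ = λ (z∈₂ , z∈₃) → apart P₂ P₃ m₂₃ z∈₂ (proj₁ (interior-∈ (walk P₃) (simple P₃) z∈₃)) }
      where
      neither : ∀ {z : V} → z ≢ s × z ≢ t → ¬ (z ≡ s ⊎ z ≡ t)
      neither (z≢s , _)   (inj₁ z≡s) = z≢s z≡s
      neither (_   , z≢t) (inj₂ z≡t) = z≢t z≡t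

      apart : ∀ {u v z} (p : Path D s t) (q : Path D u v) →
              (∀ {z} → z ∈ₚ p → z ∈ₚ q → z ≡ s ⊎ z ≡ t) →
              z ∈ interior D (walk p) → z ∈ₚ q → ⊥
      apart p q m z∈ z∈q = let (z∈p , z≢) = interior-∈ (walk p) (simple p) z∈
                           in neither z≢ (m z∈p z∈q)

    -- The first return of Q to P leads from the end y of P back to some vertex t of P,
    -- which gives the three paths γ P[x,t], Q[y,t] and P[t,y].
    theta : ∀ {x y} {K : V → Set} → x ≢ y → K x → K y →
            WalkInto K x y → WalkInto K y x →
            (γ : Path D y x) → k ≤ len γ → (∀ {z} → z ∈ₚ γ → K z → z ≡ x ⊎ z ≡ y) →
            BSubdivision D k 1 1
    theta {x} {y} {K} x≢y Kx Ky P⋆ Q⋆ γ k≤γ γ∩K with erase P⋆ | erase Q⋆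
    ... | P , P⊆ | record { walk = ε } , _ = ⊥-elim (x≢y refl)
    ... | P , P⊆ | Q@(record { walk = a ◅ w ; simple = uniq@(_ ∷ uw) }) , Q⊆ =
      spindle y≢t
        (join γ before meetγ) β after
        (ℕ.≤-trans k≤γ (ℕ.≤-trans (ℕ.m≤m+n (len γ) (len before))
          (ℕ.≤-reflexive (sym (join-length (walk γ) (walk before))))))
        (λ z∈₁ z∈β → m₁₂ (join-∈ (walk γ) (walk before) z∈₁) z∈β)
        (λ z∈₁ z∈α → m₁₃ (join-∈ (walk γ) (walk before) z∈₁) z∈α)
        (λ z∈β z∈α → β∩P z∈β (after⊆ z∈α))
      where
      P⊆K : ∀ {z} → z ∈ₚ P → K z
      P⊆K z∈ = Sum.[ (λ { refl → Kx }) , (λ Kz → Kz) ] (P⊆ z∈)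
      Q⊆K : ∀ {z} → z ∈ₚ Q → K z
      Q⊆K z∈ = Sum.[ (λ { refl → Ky }) , (λ Kz → Kz) ] (Q⊆ z∈)
      -- The search starts in the tail of `Q`, because `y` itself lies on `P`.
      open Hit (firstHit (_∈ₚ? P) w uw (first∈ (walk P)))
      open Split (split P hit)

      y∉ : ¬ (y ∈ₚ upto)
      y∉ = start∉tail {a = a} {w} uniq ∘ upto⊆

      y≢t : y ≢ t
      y≢t y≡t = y∉ (subst (_∈ₚ upto) (sym y≡t) (last∈ (walk upto)))

      β : Path D y t
      β = consPath a upto y∉

      β⊆K : ∀ {z} → z ∈ₚ β → K z
      β⊆K (here refl) = Ky
      β⊆K (there z∈)  = Q⊆K (there (upto⊆ z∈))

      β∩P : ∀ {z} → z ∈ₚ β → z ∈ₚ P → z ≡ y ⊎ z ≡ t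
      β∩P (here eq)  _   = inj₁ eq
      β∩P (there z∈) z∈P = inj₂ (fresh z∈ z∈P)

      meetγ : ∀ {z} → z ∈ₚ γ → z ∈ₚ before → z ≡ x
      meetγ z∈γ z∈b with γ∩K z∈γ (P⊆K (before⊆ z∈b))
      ... | inj₁ eq   = eq
      -- `y` is the end of `after`, so meeting it on `before` would force `y ≡ t`.
      ... | inj₂ refl = ⊥-elim (y≢t (meet z∈b (last∈ (walk after))))

      m₁₂ : ∀ {z} → z ∈ₚ γ ⊎ z ∈ₚ before → z ∈ₚ β → z ≡ y ⊎ z ≡ t
      m₁₂ (inj₂ z∈b) z∈β = β∩P z∈β (before⊆ z∈b)
      m₁₂ (inj₁ z∈γ) z∈β with γ∩K z∈γ (β⊆K z∈β)
      ... | inj₁ refl = β∩P z∈β (first∈ (walk P))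
      ... | inj₂ eq   = inj₁ eq

      m₁₃ : ∀ {z} → z ∈ₚ γ ⊎ z ∈ₚ before → z ∈ₚ after → z ≡ y ⊎ z ≡ t
      m₁₃ (inj₂ z∈b) z∈a = inj₂ (meet z∈b z∈a)
      m₁₃ (inj₁ z∈γ) z∈a with γ∩K z∈γ (P⊆K (after⊆ z∈a))
      ... | inj₁ refl = inj₂ (meet (first∈ (walk before)) z∈a)
      ... | inj₂ eq   = inj₁ eq

-- Deciding whether there is a subdivision

lookup-injective : ∀ {A : Set} {xs : List A} → Unique xs →
                   ∀ {i j} → List.lookup xs i ≡ List.lookup xs j → i ≡ j
lookup-injective (_  ∷ _)  {Fin.zero}  {Fin.zero}  _  = refl
lookup-injective (x≢ ∷ _)  {Fin.zero}  {Fin.suc j} eq = ⊥-elim (All.lookup x≢ (∈-lookup j) eq)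
lookup-injective (x≢ ∷ _)  {Fin.suc i} {Fin.zero}  eq = ⊥-elim (All.lookup x≢ (∈-lookup i) (sym eq))
lookup-injective (_  ∷ u)  {Fin.suc i} {Fin.suc j} eq = cong Fin.suc (lookup-injective u eq)

unique-length : ∀ {n} {xs : List (Fin n)} → Unique xs → List.length xs ≤ n
unique-length u = Fin.injective⇒≤ (lookup-injective u)

dropLast : ∀ {A : Set} → List A → List A
dropLast []           = []
dropLast (_ ∷ [])     = []
dropLast (x ∷ y ∷ ys) = x ∷ dropLast (y ∷ ys)

-- `interior` on bare lists, so that every condition on a path becomes a predicate on its vertex
-- list.
inner : ∀ {A : Set} → List A → List A
inner []       = []
inner (_ ∷ xs) = dropLast xs

module Decide {n : ℕ} (D : Digraph n) where
  open Digraph D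
  open Path

  private
    V = Fin n

  inner-vertices : ∀ {u v} (w : Walk D u v) → inner (vertices D w) ≡ interior D w
  inner-vertices ε                 = refl
  inner-vertices (_ ◅ ε)           = refl
  inner-vertices (a ◅ (b ◅ ε))     = refl
  inner-vertices (a ◅ (b ◅ c ◅ w)) = cong (_ ∷_) (inner-vertices (b ◅ c ◅ w))

  length-vertices : ∀ {u v} (w : Walk D u v) → List.length (vertices D w) ≡ suc (length D w)
  length-vertices ε       = refl
  length-vertices (_ ◅ w) = cong suc (length-vertices w)

  -- Recursion on the length bound; the first vertex is absorbed into the predicate, which always
  -- speaks of the whole vertex list.
  walk? : ∀ l x y {Q : List V → Set} → Decidable Q →
          Dec (Σ[ w ∈ Walk D x y ] length D w ≤ l × Q (vertices D w))
  walk? zero x y Q? with x ≟ y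
  ... | no x≢y   = no λ { (ε , _) → x≢y refl }
  ... | yes refl = map′ (λ q → ε , z≤n , q) (λ { (ε , _ , q) → q }) (Q? (x ∷ []))
  walk? (suc l) x y {Q} Q? = map′ to from
    ((x ≟ y ×-dec Q? (x ∷ [])) ⊎-dec any? λ z → arc? x z ×-dec walk? l z y (Q? ∘ (x ∷_)))
    where
    Step : Set
    Step = (x ≡ y × Q (x ∷ [])) ⊎
           ∃[ z ] Arc x z × Σ[ w ∈ Walk D z y ] length D w ≤ l × Q (x ∷ vertices D w)
    to : Step → Σ[ w ∈ Walk D x y ] length D w ≤ suc l × Q (vertices D w)
    to (inj₁ (refl , q))              = ε , z≤n , q
    to (inj₂ (_ , a , w , w≤ , q))    = a ◅ w , s≤s w≤ , q
    from : Σ[ w ∈ Walk D x y ] length D w ≤ suc l × Q (vertices D w) → Step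
    from (ε , _ , q)            = inj₁ (refl , q)
    from (a ◅ w , s≤s w≤ , q)   = inj₂ (_ , a , w , w≤ , q)

  -- A simple path has at most `n` vertices, so walks of length at most `n` exhaust the candidates.
  path? : ∀ x y {Q : List V → Set} → Decidable Q → Dec (Σ[ p ∈ Path D x y ] Q (vertices D (walk p)))
  path? x y {Q} Q? = map′
    (λ (w , _ , u , q) → record { walk = w ; simple = u } , q)
    (λ (p , q) → walk p , ℕ.≤-trans (ℕ.n≤1+n _)
       (subst (_≤ n) (length-vertices (walk p)) (unique-length (simple p))) , simple p , q)
    (walk? n x y {λ xs → Unique xs × Q xs} (λ xs → unique? _≟_ xs ×-dec Q? xs))

  Spindle : (k₁ k₂ k₃ : ℕ) (xs ys zs : List V) → Set
  Spindle k₁ k₂ k₃ xs ys zs =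
    -- Strict, since the vertex list has one entry more than the path has arcs.
    k₁ < List.length xs × k₂ < List.length ys × k₃ < List.length zs × xs ≢ ys ×
    Disjoint (inner xs) (inner ys) × Disjoint (inner xs) (inner zs) × Disjoint (inner ys) (inner zs)

  spindle? : ∀ k₁ k₂ k₃ xs ys zs → Dec (Spindle k₁ k₂ k₃ xs ys zs)
  spindle? k₁ k₂ k₃ xs ys zs =
    k₁ ℕ.<? _ ×-dec k₂ ℕ.<? _ ×-dec k₃ ℕ.<? _ ×-dec ¬? (List.≡-dec _≟_ xs ys) ×-dec
    disjoint? _≟_ _ _ ×-dec disjoint? _≟_ _ _ ×-dec disjoint? _≟_ _ _

  subdivision? : ∀ k₁ k₂ k₃ → Dec (BSubdivision D k₁ k₂ k₃)
  subdivision? k₁ k₂ k₃ = map′ to from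
    (any? λ x → any? λ y → ¬? (x ≟ y) ×-dec
     path? x y λ xs → path? x y λ ys → path? y x (spindle? k₁ k₂ k₃ xs ys))
    where
    Found : Set
    Found = ∃[ x ] ∃[ y ] x ≢ y × Σ[ P₁ ∈ Path D x y ] Σ[ P₂ ∈ Path D x y ] Σ[ P₃ ∈ Path D y x ]
      Spindle k₁ k₂ k₃ (vertices D (walk P₁)) (vertices D (walk P₂)) (vertices D (walk P₃))
    to : Found → BSubdivision D k₁ k₂ k₃
    to (x , y , x≢y , P₁ , P₂ , P₃ , l₁ , l₂ , l₃ , distinct , d₁₂ , d₁₃ , d₂₃) = record
      { x≢y = x≢y ; P₁ = P₁ ; P₂ = P₂ ; P₃ = P₃
      ; length₁ = shorten P₁ l₁ ; length₂ = shorten P₂ l₂ ; length₃ = shorten P₃ l₃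
      ; distinct = distinct
      ; disjoint₁₂ = interiors P₁ P₂ d₁₂
      ; disjoint₁₃ = interiors P₁ P₃ d₁₃
      ; disjoint₂₃ = interiors P₂ P₃ d₂₃ }
      where
      shorten : ∀ {k u v} (p : Path D u v) → k < List.length (vertices D (walk p)) → k ≤ length D (walk p)
      shorten {k} p k< = ℕ.≤-pred (subst (suc k ≤_) (length-vertices (walk p)) k<)
      interiors : ∀ {u v u′ v′} (p : Path D u v) (q : Path D u′ v′) →
                  Disjoint (inner (vertices D (walk p))) (inner (vertices D (walk q))) →
                  InternallyDisjoint D p q
      interiors p q = subst₂ Disjoint (inner-vertices (walk p)) (inner-vertices (walk q))
    from : BSubdivision D k₁ k₂ k₃ → Found
    from B = x , y , x≢y , P₁ , P₂ , P₃ ,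
      lengthen P₁ length₁ , lengthen P₂ length₂ , lengthen P₃ length₃ , distinct ,
      inners P₁ P₂ disjoint₁₂ , inners P₁ P₃ disjoint₁₃ , inners P₂ P₃ disjoint₂₃
      where
      open BSubdivision B
      lengthen : ∀ {k u v} (p : Path D u v) → k ≤ length D (walk p) → k < List.length (vertices D (walk p))
      lengthen {k} p k≤ = subst (suc k ≤_) (sym (length-vertices (walk p))) (s≤s k≤)
      inners : ∀ {u v u′ v′} (p : Path D u v) (q : Path D u′ v′) → InternallyDisjoint D p q →
               Disjoint (inner (vertices D (walk p))) (inner (vertices D (walk q)))
      inners p q = subst₂ Disjoint (sym (inner-vertices (walk p))) (sym (inner-vertices (walk q)))

-- Bondy's theorem

¬¬-all : ∀ {n} (P : Fin n → Set) → (∀ i → ¬ ¬ P i) → ¬ ¬ (∀ i → P i)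
¬¬-all {zero}  P ¬¬P ¬all = ¬all λ ()
¬¬-all {suc n} P ¬¬P ¬all = ¬¬P Fin.zero λ P₀ → ¬¬-all (P ∘ Fin.suc) (¬¬P ∘ Fin.suc) λ Pₛ →
  ¬all λ { Fin.zero → P₀ ; (Fin.suc i) → Pₛ i }

-- Whenever the goal is `⊥`, this allows case distinctions on an arbitrary predicate on the
-- vertices.
¬¬-decidable : ∀ {n} (P : Fin n → Set) → ¬ ¬ Decidable P
¬¬-decidable P = ¬¬-all (Dec ∘ P) λ _ → ¬¬-excluded-middle

∑ : ∀ {n} → (Fin n → ℕ) → ℕ
∑ {zero}  f = 0
∑ {suc n} f = f Fin.zero + ∑ (f ∘ Fin.suc)

∑-mono : ∀ {n} {f g : Fin n → ℕ} → (∀ i → f i ≤ g i) → ∑ f ≤ ∑ g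
∑-mono {zero}  f≤g = z≤n
∑-mono {suc n} f≤g = ℕ.+-mono-≤ (f≤g Fin.zero) (∑-mono (f≤g ∘ Fin.suc))

∑-mono-< : ∀ {n} {f g : Fin n → ℕ} → (∀ i → f i ≤ g i) → ∀ i → f i < g i → ∑ f < ∑ g
∑-mono-< f≤g Fin.zero    f<g = ℕ.+-mono-<-≤ f<g (∑-mono (f≤g ∘ Fin.suc))
∑-mono-< f≤g (Fin.suc i) f<g = ℕ.+-mono-≤-< (f≤g Fin.zero) (∑-mono-< (f≤g ∘ Fin.suc) i f<g)

module Congruence (L : ℕ) {{_ : NonZero L}} where

  infix 4 _≈_
  _≈_ : ℕ → ℕ → Set
  a ≈ b = a % L ≡ b % L

  +-congʳ : ∀ {a b} c → a ≈ b → a + c ≈ b + c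
  +-congʳ {a} {b} c a≈b = begin
    (a + c) % L             ≡⟨ %-distribˡ-+ a c L ⟩
    (a % L + c % L) % L     ≡⟨ cong (λ r → (r + c % L) % L) a≈b ⟩
    (b % L + c % L) % L     ≡⟨ %-distribˡ-+ b c L ⟨
    (b + c) % L             ∎
    where open ≡-Reasoning

  -- Subtracting `a` is replaced by adding `a * pred L`, which completes `a` to a multiple of `L`.
  ≈-cancel : ∀ a l → a + l ≈ a → L ∣ l
  ≈-cancel a l eq = m%n≡0⇒n∣m l L (begin
    l % L                       ≡⟨ [m+kn]%n≡m%n l a L ⟨
    (l + a * L) % L             ≡⟨ cong (_% L) (trans (ℕ.+-comm l (a * L)) (cong (_+ l) (sym a+a*pred))) ⟩
    (a + a * pred L + l) % L    ≡⟨ cong (_% L) (trans (ℕ.+-assoc a _ l) (trans (cong (a +_) (ℕ.+-comm _ l)) (sym (ℕ.+-assoc a l _)))) ⟩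
    (a + l + a * pred L) % L    ≡⟨ +-congʳ {a + l} {a} (a * pred L) eq ⟩
    (a + a * pred L) % L        ≡⟨ cong (_% L) a+a*pred ⟩
    (a * L) % L                 ≡⟨ [m+kn]%n≡m%n 0 a L ⟩
    0 % L                       ≡⟨ m<n⇒m%n≡m (>-nonZero⁻¹ L) ⟩
    0                           ∎)
    where
    open ≡-Reasoning
    a+a*pred : a + a * pred L ≡ a * L
    a+a*pred = trans (sym (ℕ.*-suc a (pred L))) (cong (a *_) (ℕ.suc-pred L))

indicator : {A : Set} → Dec A → ℕ
indicator (yes _) = 1
indicator (no _)  = 0

module Colouring {n : ℕ} (D : Digraph n) where
  open Digraph D

  ColourableOn : (Fin n → Set) → ℕ → Set
  ColourableOn S N = Σ[ f ∈ (Fin n → Fin N) ] (∀ {u v} → S u → S v → Arc u v → f u ≢ f v)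

  colourBy : ∀ {S : Fin n → Set} N {{_ : NonZero N}} (g : Fin n → ℕ) →
             (∀ {u v} → S u → S v → Arc u v → g u % N ≢ g v % N) → ColourableOn S N
  colourBy N g proper = (λ v → g v mod N) , λ {u} {v} Su Sv a eq →
    proper Su Sv a (trans (sym (Fin.toℕ-fromℕ< (m%n<n (g u) N)))
                   (trans (cong Fin.toℕ eq) (Fin.toℕ-fromℕ< (m%n<n (g v) N))))

  StrongOn : (Fin n → Set) → Set
  StrongOn S = ∀ {u v} → S u → S v → Paths.WalkInto D S u v

  -- `back` is not counted in `long`: the cycle has at least `L + 1` vertices.
  record LongCycle (S : Fin n → Set) (L : ℕ) : Set where
    field
      {u v} : Fin n
      path  : Path D u v
      back  : Arc v u
      path⊆ : ∀ {z} → z ∈ vertices D (Path.walk path) → S z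
      long  : L ≤ length D (Path.walk path)

module Bondy {n : ℕ} (D : Digraph n) (S : Fin n → Set) (S? : Decidable S)
             (strong : Colouring.StrongOn D S) (L : ℕ) {{L≢0 : NonZero L}} where
  open Digraph D
  open Colouring D
  open Congruence L
  open Paths D

  private
    V = Fin n

  -- Firing: if t u v = L, so that g fails to colour the arc u → v modulo L, raise g by one on
  -- the set U of vertices reachable from v along arcs of tension 1.  If u ∈ U there is a long
  -- cycle; otherwise no closed walk gains tension and those through u → v lose some.
  record Tension (g : V → ℕ) (t : V → V → ℕ) : Set where
    field
      1≤t : ∀ {u v} → S u → S v → Arc u v → 1 ≤ t u v
      t≤L : ∀ {u v} → S u → S v → Arc u v → t u v ≤ L
      g+t : ∀ {u v} → S u → S v → Arc u v → g u + t u v ≈ g v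

  weight : (V → V → ℕ) → ∀ {u v} → WalkInto S u v → ℕ
  weight t ε                 = 0
  weight t (_◅_ {x} {y} _ w) = t x y + weight t w

  loop? : ∀ u v → Dec (S u × S v × Arc u v)
  loop? u v = S? u ×-dec S? v ×-dec arc? u v

  -- Tension around a closed walk through the arc, with one fixed return walk. Firing never raises
  -- it, and lowers it when the arc itself wraps from `L` to 1.
  loopWeight : (V → V → ℕ) → V → V → ℕ
  loopWeight t u v with loop? u v
  ... | yes (Su , Sv , a) = t u v + weight t (strong Sv Su)
  ... | no _              = 0

  -- Every arc of `S` has its own closed walk in the sum, so the sum drops whichever monochromatic
  -- arc prompts the firing.
  measure : (V → V → ℕ) → ℕ
  measure t = ∑ λ u → ∑ λ v → loopWeight t u v

  Monochromatic : (V → V → ℕ) → V → V → Set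
  Monochromatic t u v = (S u × S v × Arc u v) × t u v ≡ L

  module Fire {g : V → ℕ} {t : V → V → ℕ} (tension : Tension g t)
              {U : V → Set} (U? : Decidable U)
              (tight-closed : ∀ {x y} → U x → S x → S y → Arc x y → t x y ≡ 1 → U y) where
    open Tension tension

    χ : V → ℕ
    χ x = indicator (U? x)

    g′ : V → ℕ
    g′ x = g x + χ x

    t′ : V → V → ℕ
    t′ x y with U? x | U? y
    ... | yes _ | no _  = pred (t x y)
    ... | no _  | yes _ with t x y ℕ.≟ L
    -- The tension of an arc entering `U` would become `L + 1`, which is reduced modulo `L`.
    ...   | yes _ = 1
    ...   | no _  = suc (t x y)
    t′ x y | yes _ | yes _ = t x y
    t′ x y | no _  | no _  = t x y

    tension′ : Tension g′ t′
    tension′ = record { 1≤t = 1≤t′ ; t≤L = t′≤L ; g+t = g′+t′ }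
      where
      1≤t′ : ∀ {x y} → S x → S y → Arc x y → 1 ≤ t′ x y
      1≤t′ {x} {y} Sx Sy a with U? x | U? y
      -- `U` is closed under tight arcs, so an arc leaving it has tension at least 2.
      ... | yes Ux | no ¬Uy = ℕ.<⇒≤pred (ℕ.≤∧≢⇒< (1≤t Sx Sy a) (¬Uy ∘ tight-closed Ux Sx Sy a ∘ sym))
      ... | no _  | yes _ with t x y ℕ.≟ L
      ...   | yes _ = s≤s z≤n
      ...   | no _  = s≤s z≤n
      1≤t′ Sx Sy a | yes _ | yes _ = 1≤t Sx Sy a
      1≤t′ Sx Sy a | no _  | no _  = 1≤t Sx Sy a
      t′≤L : ∀ {x y} → S x → S y → Arc x y → t′ x y ≤ L
      t′≤L {x} {y} Sx Sy a with U? x | U? y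
      ... | yes _ | no _  = ℕ.≤-trans ℕ.pred[n]≤n (t≤L Sx Sy a)
      ... | no _  | yes _ with t x y ℕ.≟ L
      ...   | yes _  = >-nonZero⁻¹ L
      ...   | no t≢L = ℕ.≤∧≢⇒< (t≤L Sx Sy a) t≢L
      t′≤L Sx Sy a | yes _ | yes _ = t≤L Sx Sy a
      t′≤L Sx Sy a | no _  | no _  = t≤L Sx Sy a
      g′+t′ : ∀ {x y} → S x → S y → Arc x y → g′ x + t′ x y ≈ g′ y
      g′+t′ {x} {y} Sx Sy a with U? x | U? y
      ... | yes _ | no _  = trans (cong (_% L) (begin
          g x + 1 + pred (t x y)   ≡⟨ ℕ.+-assoc (g x) 1 _ ⟩
          g x + suc (pred (t x y)) ≡⟨ cong (g x +_) (ℕ.suc-pred (t x y) {{>-nonZero (1≤t Sx Sy a)}}) ⟩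
          g x + t x y              ∎)) (trans (g+t Sx Sy a) (cong (_% L) (sym (ℕ.+-identityʳ (g y)))))
        where open ≡-Reasoning
      ... | no _  | yes _ with t x y ℕ.≟ L
      ...   | yes t≡L = +-congʳ {g x + 0} {g y} 1 (begin
          (g x + 0) % L     ≡⟨ cong (_% L) (ℕ.+-identityʳ (g x)) ⟩
          g x % L           ≡⟨ [m+n]%n≡m%n (g x) L ⟨
          (g x + L) % L     ≡⟨ cong (λ l → (g x + l) % L) t≡L ⟨
          (g x + t x y) % L ≡⟨ g+t Sx Sy a ⟩
          g y % L           ∎)
        where open ≡-Reasoning
      ...   | no t≢L = trans (cong (_% L) (begin
          g x + 0 + suc (t x y) ≡⟨ cong (_+ suc (t x y)) (ℕ.+-identityʳ (g x)) ⟩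
          g x + suc (t x y)     ≡⟨ cong (g x +_) (ℕ.+-comm 1 (t x y)) ⟩
          g x + (t x y + 1)     ≡⟨ ℕ.+-assoc (g x) (t x y) 1 ⟨
          g x + t x y + 1       ∎)) (+-congʳ {g x + t x y} {g y} 1 (g+t Sx Sy a))
        where open ≡-Reasoning
      g′+t′ {x} {y} Sx Sy a | yes _ | yes _ = trans (cong (_% L) (begin
          g x + 1 + t x y   ≡⟨ ℕ.+-assoc (g x) 1 _ ⟩
          g x + (1 + t x y) ≡⟨ cong (g x +_) (ℕ.+-comm 1 (t x y)) ⟩
          g x + (t x y + 1) ≡⟨ ℕ.+-assoc (g x) (t x y) 1 ⟨
          g x + t x y + 1   ∎)) (+-congʳ {g x + t x y} {g y} 1 (g+t Sx Sy a))
        where open ≡-Reasoning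
      g′+t′ {x} {y} Sx Sy a | no _  | no _  =
        trans (cong (λ m → (m + t x y) % L) (ℕ.+-identityʳ (g x)))
              (trans (g+t Sx Sy a) (cong (_% L) (sym (ℕ.+-identityʳ (g y)))))

    -- The tension grows by at most χ y - χ x, a difference that telescopes along walks and vanishes
    -- around closed ones. Equality fails only on wrapping from `L` to 1.
    arc-bound : ∀ {x y} → S x → S y → Arc x y → t′ x y + χ x ≤ t x y + χ y
    arc-bound {x} {y} Sx Sy a with U? x | U? y
    ... | yes _ | no _  = ℕ.≤-reflexive (trans (ℕ.+-comm _ 1)
                            (trans (ℕ.suc-pred (t x y) {{>-nonZero (1≤t Sx Sy a)}}) (sym (ℕ.+-identityʳ _))))
    ... | no _  | yes _ with t x y ℕ.≟ L
    ...   | yes _ = ℕ.m≤n+m 1 (t x y)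
    ...   | no _  = ℕ.≤-reflexive (trans (ℕ.+-identityʳ _) (ℕ.+-comm 1 (t x y)))
    arc-bound Sx Sy a | yes _ | yes _ = ℕ.≤-refl
    arc-bound Sx Sy a | no _  | no _  = ℕ.≤-refl

    arc-bound-< : ∀ {x y} → Monochromatic t x y → ¬ U x → U y → t′ x y + χ x < t x y + χ y
    arc-bound-< {x} {y} ((Sx , Sy , a) , t≡L) ¬Ux Uy with U? x | U? y
    ... | yes Ux | _      = ⊥-elim (¬Ux Ux)
    ... | no _   | no ¬Uy = ⊥-elim (¬Uy Uy)
    ... | no _   | yes _ with t x y ℕ.≟ L
    ...   | yes _  = ℕ.+-monoˡ-≤ 1 (1≤t Sx Sy a)
    ...   | no t≢L = ⊥-elim (t≢L t≡L)

    swap-mid : ∀ a b c → a + b + c ≡ a + c + b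
    swap-mid a b c = trans (ℕ.+-assoc a b c) (trans (cong (a +_) (ℕ.+-comm b c)) (sym (ℕ.+-assoc a c b)))

    walk-bound : ∀ {x y} → S x → (w : WalkInto S x y) → weight t′ w + χ x ≤ weight t w + χ y
    walk-bound Sx ε = ℕ.≤-refl
    walk-bound {x} {y} Sx (_◅_ {j = z} (a , Sz) w) = begin
      t′ x z + weight t′ w + χ x   ≡⟨ swap-mid (t′ x z) _ _ ⟩
      t′ x z + χ x + weight t′ w   ≤⟨ ℕ.+-monoˡ-≤ _ (arc-bound Sx Sz a) ⟩
      t x z + χ z + weight t′ w    ≡⟨ trans (ℕ.+-assoc (t x z) _ _) (cong (t x z +_) (ℕ.+-comm (χ z) _)) ⟩
      t x z + (weight t′ w + χ z)  ≤⟨ ℕ.+-monoʳ-≤ (t x z) (walk-bound Sz w) ⟩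
      t x z + (weight t w + χ y)   ≡⟨ ℕ.+-assoc (t x z) _ _ ⟨
      t x z + weight t w + χ y     ∎
      where open ℕ.≤-Reasoning

    loop-bound : ∀ u v → loopWeight t′ u v ≤ loopWeight t u v
    loop-bound u v with loop? u v
    ... | no _              = z≤n
    ... | yes (Su , Sv , a) = ℕ.+-cancelʳ-≤ (χ u) _ _ (walk-bound Su ((a , Sv) ◅ strong Sv Su))

    loop-bound-< : ∀ {u v} → Monochromatic t u v → ¬ U u → U v → loopWeight t′ u v < loopWeight t u v
    loop-bound-< {u} {v} mono@(arc , _) ¬Uu Uv with loop? u v
    ... | no ¬arc           = ⊥-elim (¬arc arc)
    ... | yes (Su , Sv , a) = ℕ.+-cancelʳ-< (χ u) _ _ (begin-strict
      t′ u v + w′ + χ u   ≡⟨ swap-mid (t′ u v) _ _ ⟩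
      t′ u v + χ u + w′   <⟨ ℕ.+-monoˡ-< w′ (arc-bound-< mono ¬Uu Uv) ⟩
      t u v + χ v + w′    ≡⟨ trans (ℕ.+-assoc (t u v) _ _) (cong (t u v +_) (ℕ.+-comm (χ v) w′)) ⟩
      t u v + (w′ + χ v)  ≤⟨ ℕ.+-monoʳ-≤ (t u v) (walk-bound Sv (strong Sv Su)) ⟩
      t u v + (w + χ u)   ≡⟨ ℕ.+-assoc (t u v) _ _ ⟨
      t u v + w + χ u     ∎)
      where
      open ℕ.≤-Reasoning
      w  = weight t (strong Sv Su)
      w′ = weight t′ (strong Sv Su)

    measure-< : ∀ {u v} → Monochromatic t u v → ¬ U u → U v → measure t′ < measure t
    measure-< {u} {v} mono ¬Uu Uv =
      ∑-mono-< (λ x → ∑-mono (loop-bound x)) u (∑-mono-< (loop-bound u) v (loop-bound-< mono ¬Uu Uv))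

  module Tight {g : V → ℕ} {t : V → V → ℕ} (tension : Tension g t) where
    open Tension tension

    TightArc : V → V → Set
    TightArc x y = (S x × S y × Arc x y) × t x y ≡ 1

    -- A digraph in its own right, so that loop erasure yields simple paths of tight arcs.
    tightDigraph : Digraph n
    tightDigraph = record
      { Arc = TightArc
      ; arc? = λ x y → loop? x y ×-dec (t x y ℕ.≟ 1)
      ; loopless = λ v ((_ , _ , a) , _) → loopless v a }

    module T = Paths tightDigraph

    forget : ∀ {x y} → Walk tightDigraph x y → Walk D x y
    forget ε                       = ε
    forget (((_ , _ , a) , _) ◅ w) = a ◅ forget w

    forget-vertices : ∀ {x y} (w : Walk tightDigraph x y) →
                      vertices D (forget w) ≡ vertices tightDigraph w
    forget-vertices ε       = refl
    forget-vertices (_ ◅ w) = cong (_ ∷_) (forget-vertices w)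

    forget-length : ∀ {x y} (w : Walk tightDigraph x y) →
                    length D (forget w) ≡ length tightDigraph w
    forget-length ε       = refl
    forget-length (_ ◅ w) = cong suc (forget-length w)

    climb : ∀ {x y} (w : Walk tightDigraph x y) → g x + length tightDigraph w ≈ g y
    climb {x} ε = cong (_% L) (ℕ.+-identityʳ (g x))
    climb {x} {y} (_◅_ {j = z} ((Sx , Sz , a) , t≡1) w) = begin
      (g x + suc l) % L       ≡⟨ cong (_% L) (ℕ.+-assoc (g x) 1 l) ⟨
      (g x + 1 + l) % L       ≡⟨ cong (λ m → (g x + m + l) % L) t≡1 ⟨
      (g x + t x z + l) % L   ≡⟨ +-congʳ {g x + t x z} {g z} l (g+t Sx Sz a) ⟩
      (g z + l) % L           ≡⟨ climb w ⟩
      g y % L                 ∎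
      where
      open ≡-Reasoning
      l = length tightDigraph w

    -- A tight walk closed by a monochromatic arc has length divisible by L.
    tight-cycle : ∀ {u v} → Monochromatic t u v → T.WalkInto S v u → LongCycle S L
    tight-cycle {u} {v} ((Su , Sv , a) , t≡L) w = record
      { path = record { walk = forget p ; simple = subst Unique (sym (forget-vertices p)) p-simple }
      ; back = a
      ; path⊆ = λ {z} z∈ → Sum.[ (λ { refl → Sv }) , (λ Sz → Sz) ]
                  (p⊆ (subst (z ∈_) (forget-vertices p) z∈))
      ; long = subst (L ≤_) (sym (forget-length p)) (∣⇒≤ {{nonempty p}} (≈-cancel (g v) _ (trans (climb p) u≈v))) }
      where
      erased = T.erase w
      p = Path.walk (proj₁ erased)
      p-simple = Path.simple (proj₁ erased)
      p⊆ = proj₂ erased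
      u≈v : g u ≈ g v
      u≈v = trans (sym ([m+n]%n≡m%n (g u) L)) (subst (λ l → g u + l ≈ g v) t≡L (g+t Su Sv a))
      -- Divisibility by `L` bounds only a nonzero length from below; an empty path would make the
      -- monochromatic arc a loop.
      nonempty : (p : Walk tightDigraph v u) → NonZero (length tightDigraph p)
      nonempty ε       = ⊥-elim (loopless v a)
      nonempty (_ ◅ _) = _

  fire : ¬ ColourableOn S L → ¬ LongCycle S L →
         ∀ b {g t} → Tension g t → measure t ≤ b → ⊥
  fire ¬col ¬long b {g} {t} tension m≤b
    with any? (λ u → any? (λ v → loop? u v ×-dec (t u v ℕ.≟ L)))
  -- Without an arc of tension `L`, `g` is a proper colouring modulo `L`: equal residues make `L`
  -- divide a tension between 1 and `L`.
  ... | no ¬mono = ¬col (colourBy L g λ {u} {v} Su Sv a g≡g →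
          ¬mono (u , v , (Su , Sv , a) ,
            ℕ.≤-antisym (t≤L Su Sv a)
              (∣⇒≤ {{>-nonZero (1≤t Su Sv a)}}
                (≈-cancel (g u) _ (trans (g+t Su Sv a) (sym g≡g))))))
    where open Tension tension
  -- With `⊥` as the goal, reachability along tight arcs may be taken as decidable.
  ... | yes (u , v , mono) = ¬¬-decidable U λ U? → lower U?
    where
    open Tight tension
    U : V → Set
    U = T.WalkInto S v
    tight-closed : ∀ {x y} → U x → S x → S y → Arc x y → t x y ≡ 1 → U y
    tight-closed w Sx Sy a t≡1 = w ◅◅ ((((Sx , Sy , a) , t≡1) , Sy) ◅ ε)
    lower : Decidable U → ⊥
    lower U? = descend b m≤b
      where
      open Fire tension U? tight-closed
      less : measure t′ < measure t
      less = measure-< mono (¬long ∘ tight-cycle mono) ε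
      descend : ∀ b → measure t ≤ b → ⊥
      descend zero    m≤0 = ℕ.n≮0 (ℕ.<-≤-trans less m≤0)
      descend (suc b) m≤b = fire ¬col ¬long b tension′ (ℕ.≤-pred (ℕ.<-≤-trans less m≤b))

  bondy : ¬ ColourableOn S L → ¬ ¬ LongCycle S L
  -- The constant `g` gives a tension with all values `L`, where every arc is monochromatic.
  bondy ¬col ¬long = fire ¬col ¬long _ {λ _ → 0} {λ _ _ → L} initial ℕ.≤-refl
    where
    initial : Tension (λ _ → 0) (λ _ _ → L)
    initial = record
      { 1≤t = λ _ _ _ → >-nonZero⁻¹ L ; t≤L = λ _ _ _ → ℕ.≤-refl
      ; g+t = λ _ _ _ → [m+n]%n≡m%n 0 L }

-- Cut vertices

module _ {n} {P : Fin n → Set} (P? : Decidable P) where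

  -- Passes from predicates to `Subset`, whose strict inclusion is well-founded.
  comprehension : Subset n
  comprehension = tabulate (does ∘ P?)

  ∈-comprehension⁺ : ∀ {x} → P x → x Subset.∈ comprehension
  ∈-comprehension⁺ {x} Px = lookup⇒[]= x _ (trans (lookup∘tabulate _ x) (dec-true (P? x) Px))

  ∈-comprehension⁻ : ∀ {x} → x Subset.∈ comprehension → P x
  ∈-comprehension⁻ {x} x∈ with P? x | trans (sym (lookup∘tabulate (does ∘ P?) x)) ([]=⇒lookup x∈)
  ... | yes Px | _ = Px
  ... | no _   | ()

transpose-injective : ∀ {n} (i j : Fin n) {x y} → transpose i j x ≡ transpose i j y → x ≡ y
transpose-injective i j eq =
  trans (sym (transpose-inverse j i)) (trans (cong (transpose j i) eq) (transpose-inverse j i))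

transpose-fst : ∀ {n} (i j : Fin n) → transpose i j i ≡ j
transpose-fst i j rewrite dec-true (i ≟ i) refl = refl

module Cuts {n : ℕ} (D : Digraph n) where
  open Digraph D
  open Paths D
  open Colouring D

  private
    V = Fin n

  -- out and into are stated negatively because Z need not be decidable.
  record Cut (S Z : V → Set) (z : V) : Set where
    field
      Sz  : S z
      z∉Z : ¬ Z z
      Z⊆S : ∀ {v} → Z v → S v
      {w} : V
      Zw  : Z w
      {o} : V
      So  : S o
      o∉Z : ¬ Z o
      o≢z : o ≢ z
      out : ∀ {x y} → Z x → S y → Arc x y → ¬ Z y → y ≢ z → ⊥
      into : ∀ {x y} → Z x → S y → Arc y x → ¬ Z y → y ≢ z → ⊥

  -- A walk of `S` between vertices of `T` leaves `T` from `z` and returns to `z`, so its excursions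
  -- can be cut out. In the induction, a walk starting outside `T` is replaced by one starting at
  -- `z`.
  strong-part : ∀ {S T z} → StrongOn S → Decidable T → (∀ {v} → T v → S v) →
                (∀ {x y} → T x → S y → ¬ T y → Arc x y → x ≡ z) →
                (∀ {x y} → S x → ¬ T x → T y → Arc x y → y ≡ z) →
                StrongOn T
  strong-part {S} {T} {z} strong T? T⊆S leave enter Tu Tv =
    proj₁ (shortcut (T⊆S Tu) (strong (T⊆S Tu) (T⊆S Tv)) Tv) Tu
    where
    shortcut : ∀ {u v} → S u → WalkInto S u v → T v →
               (T u → WalkInto T u v) × (¬ T u → WalkInto T z v)
    shortcut Su ε Tv = (λ _ → ε) , λ ¬Tv → ⊥-elim (¬Tv Tv)
    shortcut Su (_◅_ {j = w} (a , Sw) rest) Tv with shortcut Sw rest Tv | T? w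
    ... | inside , _ | yes Tw =
      (λ _ → (a , Tw) ◅ inside Tw) ,
      λ ¬Tu → subst (λ x → WalkInto T x _) (enter Su ¬Tu Tw a) (inside Tw)
    ... | _ , outside | no ¬Tw =
      (λ Tu → subst (λ x → WalkInto T x _) (sym (leave Tu Sw ¬Tw a)) (outside ¬Tw)) ,
      λ _ → outside ¬Tw

  module Glue {S Z : V → Set} {z : V} (cut : Cut S Z z) (Z? : Decidable Z) where
    open Cut cut

    -- The two sides of the cut, which overlap exactly in `z`.
    Piece Rest : V → Set
    Piece v = Z v ⊎ v ≡ z
    Rest v  = S v × ¬ Z v

    piece? : Decidable Piece
    piece? v = Z? v ⊎-dec (v ≟ z)

    Z-of : ∀ {v} → S v → ¬ Rest v → Z v
    Z-of {v} Sv ¬R with Z? v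
    ... | yes Zv = Zv
    ... | no ¬Zv = ⊥-elim (¬R (Sv , ¬Zv))

    z-of : ∀ {v} → ¬ Z v → (v ≢ z → ⊥) → v ≡ z
    z-of {v} ¬Zv ¬≢ with v ≟ z
    ... | yes eq = eq
    ... | no v≢z = ⊥-elim (¬≢ v≢z)

    strong-piece : StrongOn S → StrongOn Piece
    strong-piece strong = strong-part strong piece?
      Sum.[ Z⊆S , (λ { refl → Sz }) ]
      (λ { (inj₁ Zx) Sy ¬Py a → ⊥-elim (out Zx Sy a (¬Py ∘ inj₁) (¬Py ∘ inj₂))
         ; (inj₂ eq) _ _ _ → eq })
      (λ { Sx ¬Px (inj₁ Zy) a → ⊥-elim (into Zy Sx a (¬Px ∘ inj₁) (¬Px ∘ inj₂))
         ; _ _ (inj₂ eq) _ → eq })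

    strong-rest : Decidable S → StrongOn S → StrongOn Rest
    strong-rest S? strong = strong-part strong (λ v → S? v ×-dec ¬? (Z? v)) proj₁
      (λ (Sx , ¬Zx) Sy ¬Ry a → z-of ¬Zx (into (Z-of Sy ¬Ry) Sx a ¬Zx))
      (λ Sx ¬Rx (Sy , ¬Zy) a → z-of ¬Zy (out (Z-of Sx ¬Rx) Sy a ¬Zy))

    -- A transposition of colours makes the second colouring agree with the first at `z`, and every
    -- arc between `Z` and `Rest` has `z` as its end in `Rest`.
    glue : ∀ {N} → ColourableOn Piece N → ColourableOn Rest N → ColourableOn S N
    glue {N} (f , f-proper) (h , h-proper) = colour , proper
      where
      π : Fin N → Fin N
      π = transpose (h z) (f z)
      colour : V → Fin N
      colour v with Z? v
      ... | yes _ = f v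
      ... | no  _ = π (h v)
      proper : ∀ {u v} → S u → S v → Arc u v → colour u ≢ colour v
      proper {u} {v} Su Sv a with Z? u | Z? v
      ... | yes Zu | yes Zv = f-proper (inj₁ Zu) (inj₁ Zv) a
      ... | no ¬Zu | no ¬Zv = h-proper (Su , ¬Zu) (Sv , ¬Zv) a ∘ transpose-injective (h z) (f z)
      ... | yes Zu | no ¬Zv with z-of ¬Zv (out Zu Sv a ¬Zv)
      ...   | refl = λ eq → f-proper (inj₁ Zu) (inj₂ refl) a (trans eq (transpose-fst (h z) (f z)))
      proper {u} {v} Su Sv a | no ¬Zu | yes Zv with z-of ¬Zu (into Zv Su a ¬Zu)
      ... | refl = λ eq → f-proper (inj₂ refl) (inj₁ Zv) a (trans (sym (transpose-fst (h z) (f z))) eq)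

  StrongOn-resp : ∀ {S T : V → Set} → (∀ {v} → S v → T v) → (∀ {v} → T v → S v) →
                  StrongOn S → StrongOn T
  StrongOn-resp S⊆T T⊆S strong Tu Tv = Star.map (λ (a , Sv) → a , S⊆T Sv) (strong (T⊆S Tu) (T⊆S Tv))

  ColourableOn-⊆ : ∀ {S T N} → (∀ {v} → S v → T v) → ColourableOn T N → ColourableOn S N
  ColourableOn-⊆ S⊆T (f , proper) = f , λ Su Sv → proper (S⊆T Su) (S⊆T Sv)

  nonseparable-suffices : ∀ {N} →
    (∀ (S : V → Set) → Decidable S → StrongOn S → (∀ {Z z} → ¬ Cut S Z z) → ¬ ¬ ColourableOn S N) →
    StrongOn (λ _ → Unit.⊤) → ¬ ¬ ColourableOn (λ _ → Unit.⊤) N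
  nonseparable-suffices {N} base strong ¬col =
    induct ⊤ (⊂-wellFounded ⊤) (StrongOn-resp (λ _ → ∈⊤) (λ _ → Unit.tt) strong)
      (¬col ∘ ColourableOn-⊆ (λ _ → ∈⊤))
    where
    induct : ∀ X → Acc _⊂_ X → StrongOn (Subset._∈ X) → ¬ ¬ ColourableOn (Subset._∈ X) N
    induct X (acc rec) strong ¬col = base (Subset._∈ X) (_∈? X) strong no-cut ¬col
      where
      no-cut : ∀ {Z z} → ¬ Cut (Subset._∈ X) Z z
      no-cut {Z} {z} cut = ¬¬-decidable Z λ Z? →
        let open Glue cut Z?
            rest? = λ v → (v ∈? X) ×-dec ¬? (Z? v)
            part  : ∀ {P} (P? : Decidable P) → (∀ {v} → P v → v Subset.∈ X) →
                    (∃[ o ] o Subset.∈ X × ¬ P o) → StrongOn P → ¬ ¬ ColourableOn P N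
            part = λ P? P⊆X (o , o∈X , ¬Po) P-strong ¬Pcol →
              induct _ (rec ((λ v∈ → P⊆X (∈-comprehension⁻ P? v∈)) , o , o∈X , ¬Po ∘ ∈-comprehension⁻ P?))
                (StrongOn-resp (∈-comprehension⁺ P?) (∈-comprehension⁻ P?) P-strong)
                (¬Pcol ∘ ColourableOn-⊆ (∈-comprehension⁺ P?))
        -- The piece misses `o` and the rest misses `w`, so both are proper subsets.
        in part piece? Sum.[ Z⊆S , (λ { refl → Sz }) ] (o , So , Sum.[ o∉Z , o≢z ])
             (strong-piece strong) λ piece →
           part rest? proj₁ (w , Z⊆S Zw , λ (_ , ¬Zw) → ¬Zw Zw)
             (strong-rest (_∈? X) strong) λ rest →
           ¬col (glue piece rest)
        where open Cut cut

-- Ears of a long cycle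

module Segments {n : ℕ} (D : Digraph n) {u v : Fin n} (path : Path D u v) (back : Digraph.Arc D v u) where
  open Digraph D
  open Path
  open Paths D

  private
    V = Fin n

  -- `x` precedes `y` on `path`, whose consecutive stretches are `p₁`, `q` and `p₂`; `around` is the
  -- other way, from `y` to `x` through `back`.
  record Between (x y : V) : Set where
    field
      p₁   : Path D u x
      q    : Path D x y
      p₂   : Path D y v
      p₁⊆  : ∀ {z} → z ∈ₚ p₁ → z ∈ₚ path
      q⊆   : ∀ {z} → z ∈ₚ q → z ∈ₚ path
      p₂⊆  : ∀ {z} → z ∈ₚ p₂ → z ∈ₚ path
      p₁∩q : ∀ {z} → z ∈ₚ p₁ → z ∈ₚ q → z ≡ x
      q∩p₂ : ∀ {z} → z ∈ₚ q → z ∈ₚ p₂ → z ≡ y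
      p₁∩p₂ : ∀ {z} → z ∈ₚ p₁ → z ∈ₚ p₂ → ⊥
      lengths : len p₁ + (len q + len p₂) ≡ len path
      pos-x : pos path x ≡ len p₁
      pos-y : pos path y ≡ len p₁ + len q

    closing : Path D v x
    closing = consPath back p₁ (λ v∈p₁ → p₁∩p₂ v∈p₁ (last∈ (walk p₂)))

    meet-closing : ∀ {z} → z ∈ₚ p₂ → z ∈ₚ closing → z ≡ v
    meet-closing _     (here z≡v)   = z≡v
    meet-closing z∈p₂ (there z∈p₁) = ⊥-elim (p₁∩p₂ z∈p₁ z∈p₂)

    around : Path D y x
    around = join p₂ closing meet-closing

    around-cases : ∀ {z} → z ∈ₚ around → z ∈ₚ p₂ ⊎ z ∈ₚ p₁
    around-cases z∈ with join-∈ (walk p₂) (walk closing) z∈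
    ... | inj₁ z∈p₂        = inj₁ z∈p₂
    ... | inj₂ (here refl) = inj₁ (last∈ (walk p₂))
    ... | inj₂ (there z∈p₁) = inj₂ z∈p₁

    around⊆ : ∀ {z} → z ∈ₚ around → z ∈ₚ path
    around⊆ z∈ = Sum.[ p₂⊆ , p₁⊆ ] (around-cases z∈)

    q∩around : ∀ {z} → z ∈ₚ q → z ∈ₚ around → z ≡ x ⊎ z ≡ y
    q∩around z∈q z∈a with around-cases z∈a
    ... | inj₁ z∈p₂ = inj₂ (q∩p₂ z∈q z∈p₂)
    ... | inj₂ z∈p₁ = inj₁ (p₁∩q z∈p₁ z∈q)

    len-around : len q + len around ≡ suc (len path)
    len-around = begin
      len q + len around                  ≡⟨ cong (len q +_) (join-length (walk p₂) (walk closing)) ⟩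
      len q + (len p₂ + suc (len p₁))     ≡⟨ ℕ.+-assoc (len q) (len p₂) _ ⟨
      len q + len p₂ + suc (len p₁)       ≡⟨ ℕ.+-suc _ (len p₁) ⟩
      suc (len q + len p₂ + len p₁)       ≡⟨ cong suc (trans (ℕ.+-comm _ (len p₁)) lengths) ⟩
      suc (len path)                      ∎
      where open ≡-Reasoning

  between : ∀ {a b} → a ≢ b → a ∈ₚ path → b ∈ₚ path → Between a b ⊎ Between b a
  between {a} {b} a≢b a∈ b∈ = cases (A.cover b∈)
    where
    module A = Split (split path a∈)
    cases : b ∈ₚ A.before ⊎ b ∈ₚ A.after → Between a b ⊎ Between b a
    cases (inj₂ b∈after) = inj₁ record
      { p₁ = A.before ; q = B.before ; p₂ = B.after
      ; p₁⊆ = A.before⊆ ; q⊆ = A.after⊆ ∘ B.before⊆ ; p₂⊆ = A.after⊆ ∘ B.after⊆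
      ; p₁∩q = λ z∈p₁ z∈q → A.meet z∈p₁ (B.before⊆ z∈q)
      ; q∩p₂ = B.meet
      ; p₁∩p₂ = λ z∈p₁ z∈p₂ → a∉p₂ (subst (_∈ₚ B.after) (A.meet z∈p₁ (B.after⊆ z∈p₂)) z∈p₂)
      ; lengths = trans (cong (len A.before +_) B.len-split) A.len-split
      ; pos-x = A.pos-at
      ; pos-y = trans (A.pos-after b∈after) (cong (len A.before +_) B.pos-at) }
      where
      module B = Split (split A.after b∈after)
      a∉p₂ : ¬ (a ∈ₚ B.after)
      a∉p₂ a∈p₂ = a≢b (B.meet (first∈ (walk B.before)) a∈p₂)
    cases (inj₁ b∈before) = inj₂ record
      { p₁ = B.before ; q = B.after ; p₂ = A.after
      ; p₁⊆ = A.before⊆ ∘ B.before⊆ ; q⊆ = A.before⊆ ∘ B.after⊆ ; p₂⊆ = A.after⊆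
      ; p₁∩q = B.meet
      ; q∩p₂ = λ z∈q z∈p₂ → A.meet (B.after⊆ z∈q) z∈p₂
      ; p₁∩p₂ = λ z∈p₁ z∈p₂ → a∉p₁ (subst (_∈ₚ B.before) (A.meet (B.before⊆ z∈p₁) z∈p₂) z∈p₁)
      ; lengths = trans (sym (ℕ.+-assoc (len B.before) _ _))
                    (trans (cong (_+ len A.after) B.len-split) A.len-split)
      ; pos-x = trans (A.pos-before b∈before) B.pos-at
      ; pos-y = trans A.pos-at (sym B.len-split) }
      where
      module B = Split (split A.before b∈before)
      a∉p₁ : ¬ (a ∈ₚ B.before)
      a∉p₁ a∈p₁ = a≢b (B.meet a∈p₁ (last∈ (walk B.after)))

  record Arcs (a b : V) : Set where
    field
      fwd  : Path D a b
      bwd  : Path D b a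
      fwd⊆ : ∀ {z} → z ∈ₚ fwd → z ∈ₚ path
      bwd⊆ : ∀ {z} → z ∈ₚ bwd → z ∈ₚ path
      meet : ∀ {z} → z ∈ₚ fwd → z ∈ₚ bwd → z ≡ a ⊎ z ≡ b
      lengths : len fwd + len bwd ≡ suc (len path)
      -- A segment that uses the closing arc overshoots by one full turn, which is `suc (len path)`
      -- positions.
      position : pos path a + len fwd ≡ pos path b ⊎ pos path a + len fwd ≡ pos path b + suc (len path)

  arcs : ∀ {a b} → a ≢ b → a ∈ₚ path → b ∈ₚ path → Arcs a b
  arcs {a} {b} a≢b a∈ b∈ with between a≢b a∈ b∈
  ... | inj₁ B = record
    { fwd = q ; bwd = around ; fwd⊆ = q⊆ ; bwd⊆ = around⊆ ; meet = q∩around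
    ; lengths = len-around
    ; position = inj₁ (trans (cong (_+ len q) pos-x) (sym pos-y)) }
    where open Between B
  ... | inj₂ B = record
    { fwd = around ; bwd = q ; fwd⊆ = around⊆ ; bwd⊆ = q⊆
    ; meet = λ z∈a z∈q → Sum.swap (q∩around z∈q z∈a)
    ; lengths = trans (ℕ.+-comm (len around) (len q)) len-around
    ; position = inj₂ (trans (cong (_+ len around) (trans pos-y (cong (_+ len q) (sym pos-x))))
        (trans (ℕ.+-assoc _ (len q) (len around)) (cong (pos path b +_) len-around))) }
    where open Between B

-- Walks confined to a set of vertices

module Walks {n : ℕ} (D : Digraph n) where
  open Digraph D
  open Paths D
  open Path

  private
    V = Fin n

  weaken : ∀ {P Q u v} → (∀ {z} → P z → Q z) → WalkInto P u v → WalkInto Q u v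
  weaken P⊆Q = Star.map λ (a , Pv) → a , P⊆Q Pv

  -- Each vertex remembers how it was reached and how the walk goes on; membership in a strong
  -- component, or exclusion from it, is read off from that.
  trace : ∀ {P u v} → WalkInto P u v →
          WalkInto (λ z → P z × WalkInto P u z × WalkInto P z v) u v
  trace {P} {u} {v} = go ε
    where
    go : ∀ {x} → WalkInto P u x → WalkInto P x v →
         WalkInto (λ z → P z × WalkInto P u z × WalkInto P z v) x v
    go done ε              = ε
    go done ((a , Py) ◅ w) =
      (a , Py , done ◅◅ ((a , Py) ◅ ε) , w) ◅ go (done ◅◅ ((a , Py) ◅ ε)) w

  endsIn : ∀ {P u v} → P u → WalkInto P u v → P v
  endsIn Pu ε              = Pu
  endsIn Pu ((_ , Pv) ◅ w) = endsIn Pv w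

  -- Only the inner vertices are confined to `P`. For distinct `a` and `b` on the cycle,
  -- `Through Out a b` is a walk that erases to an ear, chords included.
  Through : (V → Set) → V → V → Set
  Through P u v = ∃[ w ] WalkInto P u w × Arc w v

  through-path : ∀ {P u v} → Through P u v →
                 Σ[ p ∈ Path D u v ] (∀ {z} → z ∈ₚ p → z ≡ u ⊎ z ≡ v ⊎ P z)
  through-path (w , u⇝w , a) = erase (weaken inj₂ u⇝w ◅◅ ((a , inj₁ refl) ◅ ε))

  crossing : ∀ {S T : V → Set} {u v} → Decidable T → S u → WalkInto S u v → T u → ¬ T v →
             ∃[ x ] ∃[ y ] S x × S y × Arc x y × T x × ¬ T y
  crossing T? Su ε Tu ¬Tv = ⊥-elim (¬Tv Tu)
  crossing T? Su (_◅_ {j = y} (a , Sy) w) Tu ¬Tv with T? y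
  ... | yes Ty = crossing T? Sy w Ty ¬Tv
  ... | no ¬Ty = _ , y , Su , Sy , a , Tu , ¬Ty

  steps : ∀ {P u v} → WalkInto P u v → ℕ
  steps = Star.fold (λ _ _ → ℕ) (λ _ → suc) 0

  steps-◅◅ : ∀ {P u v w} (p : WalkInto P u v) (q : WalkInto P v w) → steps (p ◅◅ q) ≡ steps p + steps q
  steps-◅◅ ε       q = refl
  steps-◅◅ (_ ◅ p) q = cong suc (steps-◅◅ p q)

-- The digraph outside a long cycle

module Core {n : ℕ} (D : Digraph n) {k : ℕ} (2≤k : 2 ≤ k) (¬B : ¬ BSubdivision D k 1 1)
            (S : Fin n → Set) (S? : Decidable S) (strong : Colouring.StrongOn D S)
            (nonseparable : ∀ {Z z} → ¬ Cuts.Cut D S Z z)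
            {L : ℕ} (2k≤L : k + k ≤ L) (cycle : Colouring.LongCycle D S L) where
  open Digraph D
  open Path
  open Paths D
  open Walks D
  open Colouring D
  open Cuts D
  open LongCycle cycle renaming (u to c₀; v to c₁)
  open Segments D path back

  private
    V = Fin n

  C Out : V → Set
  C z   = z ∈ₚ path
  Out z = S z × ¬ C z

  C? : Decidable C
  C? = _∈ₚ? path

  Cc₀ : C c₀
  Cc₀ = first∈ (walk path)

  module _ {a b} (a≢b : a ≢ b) (Ca : C a) (Cb : C b) where
    open Arcs (arcs a≢b Ca Cb)

    -- `e`, `fwd` and `bwd` form a spindle in which either `e` or `fwd` may serve as the long path.
    ear-bound : (e : Path D a b) → (∀ {z} → z ∈ₚ e → C z → z ≡ a ⊎ z ≡ b) → len e < k × len fwd < k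
    ear-bound e e∩C =
      (ℕ.≰⇒> λ k≤e → ¬B (spindle 2≤k a≢b e fwd bwd k≤e (λ z∈e z∈f → e∩C z∈e (fwd⊆ z∈f)) e∩bwd meet)) ,
      (ℕ.≰⇒> λ k≤f → ¬B (spindle 2≤k a≢b fwd e bwd k≤f (λ z∈f z∈e → e∩C z∈e (fwd⊆ z∈f)) meet e∩bwd))
      where
      e∩bwd : ∀ {z} → z ∈ₚ e → z ∈ₚ bwd → z ≡ a ⊎ z ≡ b
      e∩bwd z∈e z∈b = e∩C z∈e (bwd⊆ z∈b)

    bwd-long : Through Out a b → k ≤ len bwd
    bwd-long ear = ℕ.+-cancelˡ-≤ k k (len bwd) (begin
      k + k              ≤⟨ 2k≤L ⟩
      L                  ≤⟨ long ⟩
      len path           ≤⟨ ℕ.n≤1+n _ ⟩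
      suc (len path)     ≡⟨ lengths ⟨
      len fwd + len bwd  ≤⟨ ℕ.+-monoˡ-≤ (len bwd) (ℕ.<⇒≤ (proj₂ (ear-bound e λ z∈e Cz → end Cz (e⊆ z∈e)))) ⟩
      k + len bwd        ∎)
      where
      open ℕ.≤-Reasoning
      e = proj₁ (through-path ear)
      e⊆ = proj₂ (through-path ear)
      end : ∀ {z} → C z → z ≡ a ⊎ z ≡ b ⊎ Out z → z ≡ a ⊎ z ≡ b
      end _  (inj₁ z≡a)                = inj₁ z≡a
      end _  (inj₂ (inj₁ z≡b))         = inj₂ z≡b
      end Cz (inj₂ (inj₂ (_ , ¬Cz)))   = ⊥-elim (¬Cz Cz)

  -- An ear from a to b that enters the strongly connected set K at x and leaves it at y ≠ x:
  -- a path in K from y back to x would run against the long segment of the cycle from b to a.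
  no-crossing : ∀ {a b x y} {K PR PS : V → Set} → a ≢ b → C a → C b → x ≢ y →
                Through Out a b → K x → K y → WalkInto K x y → WalkInto K y x →
                (∀ {z} → K z → C z → z ≡ x ⊎ z ≡ y) →
                (C x → x ≡ a) → (C y → y ≡ b) → (K a → a ≡ x) → (K b → b ≡ y) →
                (R : Path D a x) → (∀ {z} → z ∈ₚ R → z ≡ a ⊎ z ≡ x ⊎ PR z) →
                (T : Path D y b) → (∀ {z} → z ∈ₚ T → z ≡ y ⊎ z ≡ b ⊎ PS z) →
                (∀ {z} → PR z → Out z × ¬ K z) → (∀ {z} → PS z → Out z × ¬ K z) →
                (∀ {z} → PR z → PS z → ⊥) → ⊥
  no-crossing {a} {b} {x} {y} {K} {PR} {PS}
    a≢b Ca Cb x≢y ear Kx Ky x⇝y y⇝x K∩C Cx Cy Ka Kb R R⊆ T T⊆ PR-out PS-out PR∩PS =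
    ¬B (theta 2≤k x≢y Kx Ky x⇝y y⇝x γ k≤γ γ∩K)
    where
    open Arcs (arcs a≢b Ca Cb)

    T∩bwd : ∀ {z} → z ∈ₚ T → z ∈ₚ bwd → z ≡ b
    T∩bwd z∈T z∈b with T⊆ z∈T
    ... | inj₁ refl        = Cy (bwd⊆ z∈b)
    ... | inj₂ (inj₁ z≡b)  = z≡b
    ... | inj₂ (inj₂ PSz)  = ⊥-elim (proj₂ (proj₁ (PS-out PSz)) (bwd⊆ z∈b))

    bwd∩R : ∀ {z} → z ∈ₚ bwd → z ∈ₚ R → z ≡ a
    bwd∩R z∈b z∈R with R⊆ z∈R
    ... | inj₁ z≡a         = z≡a
    ... | inj₂ (inj₁ refl) = Cx (bwd⊆ z∈b)
    ... | inj₂ (inj₂ PRz)  = ⊥-elim (proj₂ (proj₁ (PR-out PRz)) (bwd⊆ z∈b))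

    T∩R : ∀ {z} → z ∈ₚ T → z ∈ₚ R → ⊥
    T∩R z∈T z∈R with R⊆ z∈R | T⊆ z∈T
    ... | inj₁ refl        | inj₁ refl        = a≢b (Cy Ca)
    ... | inj₁ refl        | inj₂ (inj₁ refl) = a≢b refl
    ... | inj₁ refl        | inj₂ (inj₂ PSz)  = proj₂ (proj₁ (PS-out PSz)) Ca
    ... | inj₂ (inj₁ refl) | inj₁ refl        = x≢y refl
    ... | inj₂ (inj₁ refl) | inj₂ (inj₁ refl) = a≢b (sym (Cx Cb))
    ... | inj₂ (inj₁ refl) | inj₂ (inj₂ PSz)  = proj₂ (PS-out PSz) Kx
    ... | inj₂ (inj₂ PRz)  | inj₁ refl        = proj₂ (PR-out PRz) Ky
    ... | inj₂ (inj₂ PRz)  | inj₂ (inj₁ refl) = proj₂ (proj₁ (PR-out PRz)) Cb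
    ... | inj₂ (inj₂ PRz)  | inj₂ (inj₂ PSz)  = PR∩PS PRz PSz

    Tb : Path D y a
    Tb = join T bwd T∩bwd

    Tb∩R : ∀ {z} → z ∈ₚ Tb → z ∈ₚ R → z ≡ a
    Tb∩R z∈ z∈R with join-∈ (walk T) (walk bwd) z∈
    ... | inj₁ z∈T = ⊥-elim (T∩R z∈T z∈R)
    ... | inj₂ z∈b = bwd∩R z∈b z∈R

    -- The long path for `theta`: out of `K` along `T`, along the cycle from `b` to `a`, and into
    -- `K` along `R`. Its length comes from `bwd`.
    γ : Path D y x
    γ = join Tb R Tb∩R

    γ∩K : ∀ {z} → z ∈ₚ γ → K z → z ≡ x ⊎ z ≡ y
    γ∩K z∈ Kz with join-∈ (walk Tb) (walk R) z∈
    γ∩K z∈ Kz | inj₂ z∈R with R⊆ z∈R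
    ... | inj₁ refl       = inj₁ (Ka Kz)
    ... | inj₂ (inj₁ z≡x) = inj₁ z≡x
    ... | inj₂ (inj₂ PRz) = ⊥-elim (proj₂ (PR-out PRz) Kz)
    γ∩K z∈ Kz | inj₁ z∈Tb with join-∈ (walk T) (walk bwd) z∈Tb
    ... | inj₂ z∈b = K∩C Kz (bwd⊆ z∈b)
    ... | inj₁ z∈T with T⊆ z∈T
    ...   | inj₁ z≡y         = inj₂ z≡y
    ...   | inj₂ (inj₁ refl) = inj₂ (Kb Kz)
    ...   | inj₂ (inj₂ PSz)  = ⊥-elim (proj₂ (PS-out PSz) Kz)

    k≤γ : k ≤ len γ
    k≤γ = begin
      k                         ≤⟨ bwd-long a≢b Ca Cb ear ⟩
      len bwd                   ≤⟨ ℕ.m≤n+m (len bwd) (len T) ⟩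
      len T + len bwd           ≡⟨ join-length (walk T) (walk bwd) ⟨
      len Tb                    ≤⟨ ℕ.m≤m+n (len Tb) (len R) ⟩
      len Tb + len R            ≡⟨ join-length (walk Tb) (walk R) ⟨
      len γ                     ∎
      where open ℕ.≤-Reasoning

  infix 4 _⇝_
  _⇝_ : V → V → Set
  _⇝_ = WalkInto Out

  -- Cuts a walk from `c₀` at its last vertex on the cycle; `toC` cuts a walk to `c₀` at its first
  -- one.
  fromC : ∀ {v} → Out v → ∃[ a ] C a × a ⇝ v
  fromC {v} (Sv , ¬Cv) = Sum.fromInj₂ (λ c₀⇝v → c₀ , Cc₀ , c₀⇝v) (go (strong (path⊆ Cc₀) Sv))
    where
    go : ∀ {u} → WalkInto S u v → u ⇝ v ⊎ (∃[ a ] C a × a ⇝ v)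
    go ε = inj₁ ε
    go (_◅_ {j = w} (a , Sw) rest) with go rest | C? w
    ... | inj₂ found | _      = inj₂ found
    ... | inj₁ w⇝v   | yes Cw = inj₂ (w , Cw , w⇝v)
    ... | inj₁ w⇝v   | no ¬Cw = inj₁ ((a , Sw , ¬Cw) ◅ w⇝v)

  toC : ∀ {v} → Out v → ∃[ b ] C b × Through Out v b
  toC {v} (Sv , ¬Cv) = go ¬Cv (strong Sv (path⊆ Cc₀))
    where
    go : ∀ {u} → ¬ C u → WalkInto S u c₀ → ∃[ b ] C b × Through Out u b
    go ¬Cu ε = ⊥-elim (¬Cu Cc₀)
    go ¬Cu (_◅_ {j = w} (a , Sw) rest) with C? w
    ... | yes Cw = w , Cw , _ , ε , a
    ... | no ¬Cw with go ¬Cw rest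
    ...   | b , Cb , x , w⇝x , a′ = b , Cb , x , (a , Sw , ¬Cw) ◅ w⇝x , a′

  prepend : ∀ {P u v w} → WalkInto P u v → Through P v w → Through P u w
  prepend u⇝v (x , v⇝x , a) = x , u⇝v ◅◅ v⇝x , a

  Through-weaken : ∀ {P Q u v} → (∀ {z} → P z → Q z) → Through P u v → Through Q u v
  Through-weaken P⊆Q (w , u⇝w , a) = w , weaken P⊆Q u⇝w , a

  c₀≢c₁ : c₀ ≢ c₁
  c₀≢c₁ refl = loopless c₀ back

  otherC : ∀ c → ∃[ o ] C o × o ≢ c
  otherC c with c₀ ≟ c
  ... | no c₀≢c = c₀ , Cc₀ , c₀≢c
  ... | yes refl = c₁ , last∈ (walk path) , c₀≢c₁ ∘ sym

  -- The vertices outside the cycle that lie on closed walks through c are attached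
  -- to the rest of S only through c.
  no-return : ∀ {c v} → C c → Out v → c ⇝ v → Through Out v c → ⊥
  no-return {c} {v} Cc Out-v c⇝v v⇝c = nonseparable record
    { Sz = path⊆ Cc ; z∉Z = λ ((_ , ¬Cc) , _) → ¬Cc Cc ; Z⊆S = λ ((Sz , _) , _) → Sz
    ; Zw = Out-v , c⇝v , v⇝c
    ; So = path⊆ Co ; o∉Z = λ ((_ , ¬Co) , _) → ¬Co Co ; o≢z = o≢c
    ; out = out ; into = into }
    where
    o = proj₁ (otherC c)
    Co = proj₁ (proj₂ (otherC c))
    o≢c = proj₂ (proj₂ (otherC c))

    Back Z K : V → Set
    Back z = Through Out z c
    Z z = Out z × c ⇝ z × Back z
    K z = z ≡ c ⊎ Z z

    K∩C : ∀ {z} → K z → C z → z ≡ c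
    K∩C (inj₁ z≡c)              _  = z≡c
    K∩C (inj₂ ((_ , ¬Cz) , _)) Cz = ⊥-elim (¬Cz Cz)

    Z≢c : ∀ {z} → Z z → z ≢ c
    Z≢c ((_ , ¬Cc) , _) refl = ¬Cc Cc

    toZ : ∀ {w} → Z w → WalkInto K c w
    toZ (_ , c⇝w , w↩) = weaken (λ (Oz , c⇝z , z⇝w) → inj₂ (Oz , c⇝z , prepend z⇝w w↩)) (trace c⇝w)

    fromZ : ∀ {w} → Z w → WalkInto K w c
    fromZ (_ , c⇝w , x , w⇝x , a) =
      weaken (λ (Oz , w⇝z , z⇝x) → inj₂ (Oz , c⇝w ◅◅ w⇝z , x , z⇝x , a)) (trace w⇝x)
      ◅◅ ((a , inj₁ refl) ◅ ε)

    none : ∀ {z} → z ∈ₚ trivial c → z ≡ c ⊎ z ≡ c ⊎ ⊥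
    none (here z≡c) = inj₁ z≡c

    PS : V → Set
    PS z = Out z × ¬ Back z

    -- `K` is entered at `c` itself, so `R` is trivial. The inner vertices of `T` do not lead back
    -- to `c`, which keeps them out of `Z`.
    leave : ∀ {w b} → Z w → C b → b ≢ c → Through Out w b → Through PS w b → ⊥
    leave {w} {b} Zw@(Ow , c⇝w , w↩) Cb b≢c ear T =
      no-crossing {K = K} {λ _ → ⊥} {PS} (b≢c ∘ sym) Cc Cb (Z≢c Zw ∘ sym) (prepend c⇝w ear)
        (inj₁ refl) (inj₂ Zw) (toZ Zw) (fromZ Zw)
        (λ Kz Cz → inj₁ (K∩C Kz Cz)) (λ _ → refl) (λ Cw → ⊥-elim (proj₂ Ow Cw))
        (λ _ → refl) (λ Kb → ⊥-elim (b≢c (K∩C Kb Cb)))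
        (trivial c) none (proj₁ (through-path T)) (proj₂ (through-path T))
        (λ ()) (λ { (Oz , ¬↩) → Oz , λ { (inj₁ refl) → proj₂ Oz Cc ; (inj₂ (_ , _ , ↩)) → ¬↩ ↩ } })
        (λ ())

    out : ∀ {w q} → Z w → S q → Arc w q → ¬ Z q → q ≢ c → ⊥
    out {w} {q} Zw@(Ow , c⇝w , w↩) Sq a ¬Zq q≢c with C? q
    ... | yes Cq = leave Zw Cq q≢c (w , ε , a) (w , ε , a)
    ... | no ¬Cq = leave Zw Cb b≢c (prepend ((a , Oq) ◅ ε) q⇝b)
                     (x , (a , Oq , ¬↩) ◅ weaken (λ (Oz , q⇝z , _) → Oz , ¬↩ ∘ prepend q⇝z) (trace q⇝x) , a′)
      where
      Oq = Sq , ¬Cq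
      -- `q` is reachable from `c` through `w`, so a way back to `c` would put it into `Z`.
      ¬↩ : ¬ Back q
      ¬↩ q↩ = ¬Zq (Oq , c⇝w ◅◅ ((a , Oq) ◅ ε) , q↩)
      exit = toC Oq
      b = proj₁ exit
      Cb = proj₁ (proj₂ exit)
      q⇝b = proj₂ (proj₂ exit)
      x = proj₁ q⇝b
      q⇝x = proj₁ (proj₂ q⇝b)
      a′ = proj₂ (proj₂ q⇝b)
      b≢c : b ≢ c
      b≢c b≡c = ¬↩ (subst (Through Out q) b≡c q⇝b)

    PR : V → Set
    PR z = Out z × ¬ (c ⇝ z)

    -- Mirror image of `leave`: `K` is left at `c`, so now `T` is trivial.
    enter : ∀ {w a} → Z w → C a → a ≢ c → a ⇝ w → Through PR a w → ⊥
    enter {w} {a} Zw@(Ow , c⇝w , w↩) Ca a≢c a⇝w R =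
      no-crossing {K = K} {PR} {λ _ → ⊥} a≢c Ca Cc (Z≢c Zw) (prepend a⇝w w↩)
        (inj₂ Zw) (inj₁ refl) (fromZ Zw) (toZ Zw)
        (λ Kz Cz → inj₂ (K∩C Kz Cz)) (λ Cw → ⊥-elim (proj₂ Ow Cw)) (λ _ → refl)
        (λ Ka → ⊥-elim (a≢c (K∩C Ka Ca))) (λ _ → refl)
        (proj₁ (through-path R)) (proj₂ (through-path R)) (trivial c) none
        (λ { (Oz , ¬⇝) → Oz , λ { (inj₁ refl) → proj₂ Oz Cc ; (inj₂ (_ , c⇝z , _)) → ¬⇝ c⇝z } })
        (λ ()) (λ _ ())

    into : ∀ {w q} → Z w → S q → Arc q w → ¬ Z q → q ≢ c → ⊥
    into {w} {q} Zw@(Ow , c⇝w , w↩) Sq a ¬Zq q≢c with C? q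
    ... | yes Cq = enter Zw Cq q≢c ((a , Ow) ◅ ε) (q , ε , a)
    ... | no ¬Cq = enter Zw Ca a≢c (a⇝q ◅◅ ((a , Ow) ◅ ε))
                     (q , weaken (λ (Oz , _ , z⇝q) → Oz , λ c⇝z → ¬⇝ (c⇝z ◅◅ z⇝q)) (trace a⇝q) , a)
      where
      Oq = Sq , ¬Cq
      ¬⇝ : ¬ (c ⇝ q)
      ¬⇝ c⇝q = ¬Zq (Oq , c⇝q , prepend ((a , Ow) ◅ ε) w↩)
      entry = fromC Oq
      Ca = proj₁ (proj₂ entry)
      a⇝q = proj₂ (proj₂ entry)
      a≢c : proj₁ entry ≢ c
      a≢c a≡c = ¬⇝ (subst (_⇝ q) a≡c a⇝q)

  -- A nontrivial strong component K of the outside is entered and left at a single vertex.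
  acyclic : ∀ {u v} → Out u → Out v → u ≢ v → u ⇝ v → v ⇝ u → ⊥
  acyclic {u} {v} Ou Ov u≢v u⇝v v⇝u = ¬¬-decidable K contradiction
    where
    K PR PS : V → Set
    K z  = Out z × u ⇝ z × z ⇝ u
    -- Ways into `K` avoid what `u` reaches, while ways out stay within it without leading back to
    -- `u`; this makes `PR` and `PS` disjoint from `K` and from each other.
    PR z = Out z × ¬ (u ⇝ z)
    PS z = Out z × ¬ (z ⇝ u) × u ⇝ z

    Entry Exit : V → Set
    Entry x = K x × ∃[ a ] C a × Through PR a x
    Exit y  = K y × ∃[ b ] C b × Through PS y b

    inK : ∀ {x y} → K x → K y → WalkInto K x y
    inK (_ , u⇝x , x⇝u) (_ , u⇝y , y⇝u) =
      weaken (λ (Oz , x⇝z , z⇝y) → Oz , u⇝x ◅◅ x⇝z , z⇝y ◅◅ y⇝u) (trace (x⇝u ◅◅ u⇝y))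

    clash : ∀ {x y} → Entry x → Exit y → x ≢ y → ⊥
    clash {x} {y} (Kx@(Ox , u⇝x , x⇝u) , a , Ca , R@(w , a⇝w , arc)) (Ky@(Oy , u⇝y , _) , b , Cb , T) x≢y =
      no-crossing {K = K} {PR} {PS} a≢b Ca Cb x≢y (prepend a⇝x x⇝b) Kx Ky (inK Kx Ky) (inK Ky Kx)
        (λ { ((_ , ¬Cz) , _) Cz → ⊥-elim (¬Cz Cz) })
        (⊥-elim ∘ proj₂ Ox) (⊥-elim ∘ proj₂ Oy)
        (λ { ((_ , ¬Ca) , _) → ⊥-elim (¬Ca Ca) }) (λ { ((_ , ¬Cb) , _) → ⊥-elim (¬Cb Cb) })
        (proj₁ (through-path R)) (proj₂ (through-path R))
        (proj₁ (through-path T)) (proj₂ (through-path T))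
        (λ (Oz , ¬u⇝z) → Oz , λ (_ , u⇝z , _) → ¬u⇝z u⇝z)
        (λ (Oz , ¬z⇝u , _) → Oz , λ (_ , _ , z⇝u) → ¬z⇝u z⇝u)
        (λ (_ , ¬u⇝z) (_ , _ , u⇝z) → ¬u⇝z u⇝z)
      where
      a⇝x : a ⇝ x
      a⇝x = weaken proj₁ a⇝w ◅◅ ((arc , Ox) ◅ ε)
      x⇝b : Through Out x b
      x⇝b = prepend (x⇝u ◅◅ u⇝y) (Through-weaken proj₁ T)
      -- A walk through the outside that returns to its start on the cycle is excluded by
      -- `no-return`.
      a≢b : a ≢ b
      a≢b refl = no-return Ca Ox a⇝x x⇝b

    entry : ∀ {q x} → S q → ¬ K q → K x → Arc q x → Entry x
    entry {q} {x} Sq ¬Kq Kx@(Ox , _ , x⇝u) a with C? q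
    ... | yes Cq = Kx , q , Cq , q , ε , a
    ... | no ¬Cq with fromC (Sq , ¬Cq)
    ...   | c , Cc , c⇝q = Kx , c , Cc , q , weaken (λ (Oz , _ , z⇝q) → Oz , λ u⇝z → ¬u⇝q (u⇝z ◅◅ z⇝q)) (trace c⇝q) , a
      where
      ¬u⇝q : ¬ (u ⇝ q)
      ¬u⇝q u⇝q = ¬Kq ((Sq , ¬Cq) , u⇝q , (a , Ox) ◅ x⇝u)

    exit : ∀ {y q} → K y → S q → ¬ K q → Arc y q → Exit y
    exit {y} {q} Ky@(_ , u⇝y , _) Sq ¬Kq a with C? q
    ... | yes Cq = Ky , q , Cq , y , ε , a
    ... | no ¬Cq with toC (Sq , ¬Cq)
    ...   | c , Cc , x , q⇝x , a′ = Ky , c , Cc , x ,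
            (a , Oq , ¬q⇝u , u⇝q) ◅
              weaken (λ (Oz , q⇝z , _) → Oz , (λ z⇝u → ¬q⇝u (q⇝z ◅◅ z⇝u)) , u⇝q ◅◅ q⇝z) (trace q⇝x) , a′
      where
      Oq = Sq , ¬Cq
      u⇝q : u ⇝ q
      u⇝q = u⇝y ◅◅ ((a , Oq) ◅ ε)
      ¬q⇝u : ¬ (q ⇝ u)
      ¬q⇝u q⇝u = ¬Kq (Oq , u⇝q , q⇝u)

    contradiction : Decidable K → ⊥
    -- As `S` is strong, some arc enters `K` and some arc leaves it.
    contradiction K? with crossing (¬? ∘ K?) (path⊆ Cc₀) (strong (path⊆ Cc₀) (proj₁ Ou))
                            (λ ((_ , ¬Cc₀) , _) → ¬Cc₀ Cc₀) (λ ¬Ku → ¬Ku (Ou , ε , ε))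
                        | crossing K? (proj₁ Ou) (strong (proj₁ Ou) (path⊆ Cc₀)) (Ou , ε , ε)
                            (λ ((_ , ¬Cc₀) , _) → ¬Cc₀ Cc₀)
    ... | q , x , Sq , Sx , a , ¬Kq , ¬¬Kx | y , r , Sy , Sr , a′ , Ky , ¬Kr =
      case-x (K? x)
      where
      module _ (Kx : K x) where
        x-entry : Entry x
        x-entry = entry Sq ¬Kq Kx a
        y-exit : Exit y
        y-exit = exit Ky Sr ¬Kr a′
        x≡y : x ≡ y
        x≡y with x ≟ y
        ... | yes eq = eq
        ... | no x≢y = ⊥-elim (clash x-entry y-exit x≢y)
        -- Since `u ≢ v`, removing `x` leaves a vertex of `K`.
        another : ∃[ w ] K w × w ≢ x
        another with u ≟ x
        ... | no u≢x   = u , (Ou , ε , ε) , u≢x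
        ... | yes refl = v , (Ov , u⇝v , v⇝u) , u≢v ∘ sym
        -- An arc joining another vertex of `K` to the complement of `K` would give an entry or exit
        -- that clashes with those at `x`; hence `x` is a cut vertex.
        separated : ⊥
        separated = nonseparable {λ z → K z × z ≢ x} {x} record
          { Sz = Sx ; z∉Z = λ (_ , x≢x) → x≢x refl ; Z⊆S = λ (((Sz , _) , _) , _) → Sz
          ; Zw = proj₂ another
          ; So = path⊆ Cc₀ ; o∉Z = λ (((_ , ¬Cc₀) , _) , _) → ¬Cc₀ Cc₀
          ; o≢z = λ { refl → proj₂ (proj₁ Kx) Cc₀ }
          ; out = λ (Kw , w≢x) Sq a ¬Zq q≢x →
              clash x-entry (exit Kw Sq (λ Kq → ¬Zq (Kq , q≢x)) a) (w≢x ∘ sym)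
          ; into = λ (Kw , w≢x) Sq a ¬Zq q≢x →
              clash (entry Sq (λ Kq → ¬Zq (Kq , q≢x)) Kw a) y-exit (λ w≡y → w≢x (trans w≡y (sym x≡y))) }
      case-x : Dec (K x) → ⊥
      case-x (yes Kx) = separated Kx
      case-x (no ¬Kx) = ¬¬Kx ¬Kx

  -- By acyclicity such a walk repeats no vertex, so it becomes a path without losing any arcs to
  -- loop erasure.
  simpleOut : ∀ {x y} → (w : x ⇝ y) →
              Σ[ p ∈ Path D x y ] len p ≡ steps w × (∀ {z} → z ∈ₚ p → z ≡ x ⊎ Out z × x ⇝ z)
  simpleOut ε = trivial _ , refl , λ { (here z≡x) → inj₁ z≡x }
  simpleOut {x} (_◅_ {j = y} (a , Oy) w) with simpleOut w
  ... | p , len≡ , p⊆ = consPath a p x∉p , cong suc len≡ ,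
    λ { (here z≡x) → inj₁ z≡x ; (there z∈p) → inj₂ (reached (p⊆ z∈p)) }
    where
    reached : ∀ {z} → z ≡ y ⊎ Out z × y ⇝ z → Out z × x ⇝ z
    reached (inj₁ refl)       = Oy , (a , Oy) ◅ ε
    reached (inj₂ (Oz , y⇝z)) = Oz , (a , Oy) ◅ y⇝z
    x∉p : ¬ (x ∈ₚ p)
    x∉p x∈p with p⊆ x∈p
    ... | inj₁ refl       = loopless x a
    ... | inj₂ (Ox , y⇝x) = acyclic Ox Oy (λ { refl → loopless x a }) ((a , Oy) ◅ ε) y⇝x

  -- Extending `w` backwards and forwards to the cycle adds at least one arc at each end, whence the
  -- 2. The ends differ by `no-return`, so the result is an ear.
  outside-short : ∀ {u v} → Out u → (w : u ⇝ v) → 2 + steps w < k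
  outside-short {u} {v} Ou w with fromC Ou | toC (endsIn Ou w)
  ... | a , Ca , ε | _ = ⊥-elim (proj₂ Ou Ca)
  ... | a , Ca , a⇝u@(first ◅ a⇝′u) | b , Cb , x , v⇝x , arc =
    ℕ.≤-<-trans (begin
      2 + steps w                   ≤⟨ s≤s (s≤s (ℕ.≤-trans (ℕ.m≤m+n _ (steps v⇝x)) (ℕ.m≤n+m _ (steps a⇝′u)))) ⟩
      2 + (steps a⇝′u + (steps w + steps v⇝x))  ≡⟨ cong suc steps-whole ⟨
      suc (steps whole)             ≡⟨ ℕ.+-comm 1 _ ⟩
      steps whole + 1               ≡⟨ cong (_+ 1) len≡ ⟨
      len p + 1                     ≡⟨ join-length (walk p) (walk last) ⟨
      len ear                       ∎) (proj₁ (ear-bound a≢b Ca Cb ear ear∩C))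
    where
    open ℕ.≤-Reasoning
    whole : a ⇝ x
    whole = a⇝u ◅◅ (w ◅◅ v⇝x)
    steps-whole : steps whole ≡ suc (steps a⇝′u + (steps w + steps v⇝x))
    steps-whole = trans (steps-◅◅ a⇝u (w ◅◅ v⇝x)) (cong (steps a⇝u +_) (steps-◅◅ w v⇝x))
    p = proj₁ (simpleOut whole)
    len≡ = proj₁ (proj₂ (simpleOut whole))
    p⊆ = proj₂ (proj₂ (simpleOut whole))
    Ox : Out x
    Ox = endsIn Ou (w ◅◅ v⇝x)
    a≢b : a ≢ b
    a≢b refl = no-return Ca Ox whole (x , ε , arc)
    x≢b : x ≢ b
    x≢b refl = proj₂ Ox Cb
    last : Path D x b
    last = consPath arc (trivial b) λ { (here x≡b) → x≢b x≡b }
    b∉p : ¬ (b ∈ₚ p)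
    b∉p b∈p with p⊆ b∈p
    ... | inj₁ b≡a             = a≢b (sym b≡a)
    ... | inj₂ ((_ , ¬Cb) , _) = ¬Cb Cb
    ear : Path D a b
    ear = join p last λ { _ (here z≡x) → z≡x ; z∈p (there (here refl)) → ⊥-elim (b∉p z∈p) }
    ear∩C : ∀ {z} → z ∈ₚ ear → C z → z ≡ a ⊎ z ≡ b
    ear∩C z∈ Cz with join-∈ (walk p) (walk last) z∈
    ... | inj₂ (here refl)         = ⊥-elim (proj₂ Ox Cz)
    ... | inj₂ (there (here z≡b))  = inj₂ z≡b
    ... | inj₁ z∈p with p⊆ z∈p
    ...   | inj₁ z≡a               = inj₁ z≡a
    ...   | inj₂ ((_ , ¬Cz) , _)   = ⊥-elim (¬Cz Cz)

  -- The length of a longest outside walk ending at `v`, as a relation because its existence is only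
  -- shown under double negation.
  Level : V → ℕ → Set
  Level v l = (∃[ u ] Out u × Σ[ w ∈ u ⇝ v ] steps w ≡ l) × (∀ {u} → Out u → (w : u ⇝ v) → steps w ≤ l)

  -- Starting from `k`, an upper bound that is not attained can be lowered by one; the empty walk
  -- attains zero.
  level-exists : ∀ {v} → Out v → ¬ ¬ (∃[ l ] Level v l)
  level-exists {v} Ov none =
    maximum k (λ Ou w → ℕ.≤-trans (ℕ.m≤n+m _ 2) (ℕ.<⇒≤ (outside-short Ou w)))
    where
    maximum : ∀ b → (∀ {u} → Out u → (w : u ⇝ v) → steps w ≤ b) → ⊥
    maximum b bound = ¬¬-excluded-middle {A = ∃[ u ] Out u × Σ[ w ∈ u ⇝ v ] steps w ≡ b} λ
      { (yes attained)   → none (b , attained , bound)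
      ; (no unattained) → lower b bound unattained }
      where
      lower : ∀ b → (∀ {u} → Out u → (w : u ⇝ v) → steps w ≤ b) →
              ¬ (∃[ u ] Out u × Σ[ w ∈ u ⇝ v ] steps w ≡ b) → ⊥
      lower zero    bound unattained = unattained (v , Ov , ε , refl)
      lower (suc b) bound unattained = maximum b λ Ou w →
        ℕ.≤-pred (ℕ.≤∧≢⇒< (bound Ou w) λ eq → unattained (_ , Ou , w , eq))

  -- Colouring the cycle and its outside

  instance
    k≢0 : NonZero k
    k≢0 = >-nonZero (ℕ.≤-trans (s≤s z≤n) 2≤k)

  m : ℕ
  m = len path

  -- Along the cycle the colours 0, …, k-1 repeat, except that the last k-1 of the
  -- positions 0, …, m get further colours, so that chords across the closing arc are harmless.
  cycleColour : ℕ → ℕ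
  cycleColour i with suc m ℕ.<? i + k
  ... | yes _ = k + (m ∸ i)
  ... | no  _ = i % k

  cycleColour-< : ∀ i → cycleColour i < k + k
  cycleColour-< i with suc m ℕ.<? i + k
  ... | yes m<i+k = ℕ.+-monoʳ-< k (ℕ.≤-<-trans (ℕ.∸-monoˡ-≤ i (ℕ.n≤1+n m))
                      (ℕ.m<n+o⇒m∸n<o (suc m) i m<i+k))
  ... | no  _     = ℕ.<-≤-trans (m%n<n i k) (ℕ.m≤m+n k k)

  cycleColour-≢ : ∀ {i j d} → i ≤ m → j ≤ m → 0 < d → d < k →
                  i + d ≡ j ⊎ i + d ≡ j + suc m → cycleColour i ≢ cycleColour j
  cycleColour-≢ {i} {j} {d} i≤m j≤m 0<d d<k i+d eq with suc m ℕ.<? i + k | suc m ℕ.<? j + k | i+d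
  ... | yes _    | no _      | _ = ℕ.<-irrefl (sym eq) (ℕ.<-≤-trans (m%n<n j k) (ℕ.m≤m+n k _))
  ... | no _     | yes _     | _ = ℕ.<-irrefl eq (ℕ.<-≤-trans (m%n<n i k) (ℕ.m≤m+n k _))
  ... | yes _    | yes _     | inj₁ refl =
    ℕ.<-irrefl (ℕ.∸-cancelˡ-≡ i≤m j≤m (ℕ.+-cancelˡ-≡ k _ _ eq)) (ℕ.m<m+n i 0<d)
  ... | no _     | no _      | inj₁ refl =
    ℕ.<⇒≱ d<k (∣⇒≤ {{>-nonZero 0<d}} (Congruence.≈-cancel k i d (sym eq)))
  -- A chord across the closing arc starts among the last positions, whose colours are not residues.
  ... | no m≮i+k | no _      | inj₂ i+d≡ =
    m≮i+k (ℕ.≤-<-trans (ℕ.m≤n+m (suc m) j) (subst (_< i + k) i+d≡ (ℕ.+-monoʳ-< i d<k)))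
  -- Such a chord ends at `j < k`, and `j` cannot also be among the last positions because
  -- `k + k ≤ m`.
  ... | yes _    | yes m<j+k | inj₂ i+d≡ = ℕ.<-irrefl refl (begin-strict
      suc m           <⟨ m<j+k ⟩
      j + k           ≤⟨ ℕ.+-monoˡ-≤ k (ℕ.<⇒≤ j<k) ⟩
      k + k           ≤⟨ 2k≤L ⟩
      L               ≤⟨ long ⟩
      m               ≤⟨ ℕ.n≤1+n m ⟩
      suc m           ∎)
    where
    open ℕ.≤-Reasoning
    j<k : j < k
    j<k = ℕ.+-cancelʳ-< m j k (begin-strict
      j + m           ≤⟨ ℕ.+-monoʳ-≤ j (ℕ.n≤1+n m) ⟩
      j + suc m       ≡⟨ i+d≡ ⟨
      i + d           <⟨ ℕ.+-monoʳ-< i d<k ⟩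
      i + k           ≤⟨ ℕ.+-monoˡ-≤ k i≤m ⟩
      m + k           ≡⟨ ℕ.+-comm m k ⟩
      k + m           ∎)

  -- A chord is itself an ear, so the segment that it spans is shorter than `k`.
  chord-proper : ∀ {u v} → C u → C v → Arc u v → cycleColour (pos path u) ≢ cycleColour (pos path v)
  chord-proper {u} {v} Cu Cv a =
    cycleColour-≢ (pos≤length (walk path) Cu) (pos≤length (walk path) Cv)
      (nontrivial u≢v (walk fwd))
      (proj₂ (ear-bound u≢v Cu Cv (consPath a (trivial v) λ { (here u≡v) → u≢v u≡v })
        λ { (here z≡u) _ → inj₁ z≡u ; (there (here z≡v)) _ → inj₂ z≡v }))
      position
    where
    u≢v : u ≢ v
    u≢v refl = loopless u a
    open Arcs (arcs u≢v Cu Cv)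

  colourable : ∀ {N} {{_ : NonZero N}} → k + k + k ≤ N → ¬ ¬ ColourableOn S N
  -- Levels are chosen for all vertices at once, under a single double negation.
  colourable {N} 3k≤N ¬col = ¬¬-all (λ v → Out v → ∃[ l ] Level v l) level λ level →
    ¬col (colourBy N (colour level) λ Su Sv a eq → colour-proper level Su Sv a
      (trans (sym (m<n⇒m%n≡m (colour-< level _))) (trans eq (m<n⇒m%n≡m (colour-< level _)))))
    where
    level : ∀ v → ¬ ¬ (Out v → ∃[ l ] Level v l)
    level v ¬level = ¬level λ Ov → ⊥-elim (level-exists Ov λ l → ¬level λ _ → l)

    module _ (level : ∀ v → Out v → ∃[ l ] Level v l) where
      colour : V → ℕ
      colour v with C? v | S? v
      ... | yes _  | _      = cycleColour (pos path v)
      -- The offset clears the colours of the cycle, and levels are below `k`.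
      ... | no ¬Cv | yes Sv = k + k + proj₁ (level v (Sv , ¬Cv))
      -- Default value outside `S`, where nothing is required.
      ... | no _   | no _   = 0

      colour-< : ∀ v → colour v < N
      colour-< v with C? v | S? v
      ... | yes _  | _      = ℕ.<-≤-trans (cycleColour-< (pos path v)) (ℕ.≤-trans (ℕ.m≤m+n (k + k) k) 3k≤N)
      ... | no _   | no _   = >-nonZero⁻¹ N
      ... | no ¬Cv | yes Sv with level v (Sv , ¬Cv)
      ...   | l , (_ , Ou , w , refl) , _ =
        ℕ.<-≤-trans (ℕ.+-monoʳ-< (k + k) (ℕ.≤-<-trans (ℕ.m≤n+m _ 2) (outside-short Ou w))) 3k≤N

      colour-proper : ∀ {u v} → S u → S v → Arc u v → colour u ≢ colour v
      colour-proper {u} {v} Su Sv a with C? u | C? v | S? u | S? v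
      ... | _      | _      | no ¬Su | _      = ⊥-elim (¬Su Su)
      ... | _      | _      | _      | no ¬Sv = ⊥-elim (¬Sv Sv)
      ... | yes Cu | yes Cv | yes _  | yes _  = chord-proper Cu Cv a
      ... | yes _  | no _   | yes _  | yes _  =
        λ eq → ℕ.<-irrefl eq (ℕ.<-≤-trans (cycleColour-< (pos path u)) (ℕ.m≤m+n _ _))
      ... | no _   | yes _  | yes _  | yes _  =
        λ eq → ℕ.<-irrefl (sym eq) (ℕ.<-≤-trans (cycleColour-< (pos path v)) (ℕ.m≤m+n _ _))
      ... | no ¬Cu | no ¬Cv | yes Su | yes Sv with level u (Su , ¬Cu) | level v (Sv , ¬Cv)
      -- The arc prolongs a longest walk ending at `u`, so levels strictly increase along arcs
      -- outside the cycle.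
      ...   | _ , (_ , Ow , w , refl) , _ | l , _ , longest = λ eq →
        ℕ.<-irrefl (ℕ.+-cancelˡ-≡ (k + k) _ _ eq)
          (ℕ.≤-trans (ℕ.≤-reflexive (trans (ℕ.+-comm 1 _) (sym (steps-◅◅ w ((a , Sv , ¬Cv) ◅ ε)))))
            (longest Ow (w ◅◅ ((a , Sv , ¬Cv) ◅ ε))))

-- Factor by factor: `k` against `2 * k ∸ 2`, and 3 against `2 * k ∸ 3`, with equality in the latter
-- at `k = 3`.
enough-colours : ∀ k → 3 ≤ k → k + k + k ≤ (2 * k ∸ 2) * (2 * k ∸ 3)
enough-colours k 3≤k = begin
  k + k + k                      ≡⟨ trans (ℕ.+-assoc k k k) (cong (λ x → k + (k + x)) (sym (ℕ.+-identityʳ k))) ⟩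
  3 * k                          ≡⟨ ℕ.*-comm 3 k ⟩
  k * 3                          ≤⟨ ℕ.*-mono-≤ k≤ 3≤ ⟩
  (2 * k ∸ 2) * (2 * k ∸ 3)      ∎
  where
  open ℕ.≤-Reasoning
  k≤ : k ≤ 2 * k ∸ 2
  k≤ = ℕ.m+n≤o⇒m≤o∸n k (ℕ.≤-trans (ℕ.+-monoʳ-≤ k (ℕ.≤-trans (ℕ.n≤1+n 2) 3≤k))
         (ℕ.+-monoʳ-≤ k (ℕ.≤-reflexive (sym (ℕ.+-identityʳ k)))))
  3≤ : 3 ≤ 2 * k ∸ 3
  3≤ = ℕ.∸-monoˡ-≤ 3 (ℕ.*-monoʳ-≤ 2 3≤k)

mainTheorem3 : ∀ (k : ℕ) → k ≥ 3 →
    ∀ {n : ℕ} (D : Digraph n) → StronglyConnected D →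
    ∀ (χ : ℕ) → IsChromaticNumber D χ →
    χ > (2 * k ∸ 2) * (2 * k ∸ 3) →
    BSubdivision D k 1 1
mainTheorem3 k k≥3 D strong χ (_ , minimal) χ>N =
  -- Decidability turns the classical refutation of `¬B` into an actual subdivision.
  decidable-stable (subdivision? k 1 1) λ ¬B →
    nonseparable-suffices (base ¬B) strongOn λ (f , proper) →
      ℕ.<⇒≱ χ>N (minimal N (f , λ
        { _ _ (Sym.fwd a) → proper _ _ a
        ; _ _ (Sym.bwd a) eq → proper _ _ a (sym eq) }))
  where
  open Decide D
  open Cuts D
  open Colouring D

  N : ℕ
  N = (2 * k ∸ 2) * (2 * k ∸ 3)

  2≤k : 2 ≤ k
  2≤k = ℕ.≤-trans (ℕ.n≤1+n 2) k≥3

  3k≤N : k + k + k ≤ N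
  3k≤N = enough-colours k k≥3

  instance
    N≢0 : NonZero N
    N≢0 = >-nonZero (ℕ.≤-trans (ℕ.≤-trans (s≤s z≤n) k≥3) (ℕ.≤-trans (ℕ.m≤n+m k (k + k)) 3k≤N))

  strongOn : StrongOn (λ _ → Unit.⊤)
  strongOn {u} {v} _ _ with u ≟ v
  ... | yes refl = ε
  ... | no u≢v   = Star.map (λ a → a , Unit.tt) (Path.walk (strong u v u≢v))

  base : ¬ BSubdivision D k 1 1 → ∀ S → Decidable S → StrongOn S → (∀ {Z z} → ¬ Cut S Z z) →
         ¬ ¬ ColourableOn S N
  -- If `S` had no colouring with `N` colours, `bondy` would provide a cycle with more than `N`
  -- vertices, from which `Core` obtains such a colouring.
  base ¬B S S? strong nonseparable ¬col = Bondy.bondy D S S? strong N ¬col λ cycle →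
    Core.colourable D 2≤k ¬B S S? strong nonseparable (ℕ.≤-trans (ℕ.m≤m+n (k + k) k) 3k≤N) cycle
      3k≤N ¬col
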